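{- There exists an absolute constant $C$ such that the following holds. For every graph $G$ on $n$ vertices with $k \ge 1$ edges, if $m$ is a positive integer such that $m \geq C\big((nk)^{1/3} + k^{2/3} (\log k)^{1/3}\big)$, then there is a grid-drawing of $G$ in $[m]^3$.
   Context: For a positive integer $m$, $[m]=\{0,1,\ldots,m-1\}$. A grid-drawing of a graph $G$ in $[m]^3$ is a representation of $G$ in which the vertices are mapped to distinct points of $[m]^3\subseteq\mathbb{Z}^3$ and each edge is drawn as the straight-line segment between the images of its endpoints, such that (i) no edge's segment contains the image of a vertex not incident to that edge, and (ii) no two edges' segments share a common interior point. -}

module Defs where

open import Data.Nat using (ℕ; _+_; _*_; _≤_)
open import Data.Fin using (Fin; toℕ)
open import Data.Product using (Σ; _×_; _,_; proj₁; proj₂; ∃-syntax)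
open import Data.Sum using (_⊎_)
open import Data.Empty using (⊥)
open import Relation.Binary.PropositionalEquality using (_≡_; _≢_)

SameEdge : ∀ {n} → Fin n × Fin n → Fin n × Fin n → Set
SameEdge (a , b) (c , d) = (a ≡ c × b ≡ d) ⊎ (a ≡ d × b ≡ c)

record Graph (n k : ℕ) : Set where
  field
    edge     : Fin k → Fin n × Fin n
    loopless : ∀ e → proj₁ (edge e) ≢ proj₂ (edge e)
    distinct : ∀ e f → SameEdge (edge e) (edge f) → e ≡ f
open Graph public

Point : ℕ → Set
Point m = Fin m × Fin m × Fin m

px py pz : ∀ {m} → Point m → ℕ
px (x , _ , _) = toℕ x
py (_ , y , _) = toℕ y
pz (_ , _ , z) = toℕ z

Comb : ∀ {m} → ℕ → ℕ → Point m → Point m → Point m → Set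
Comb s t a b p =
  ((s + t) * px p ≡ s * px a + t * px b) ×
  ((s + t) * py p ≡ s * py a + t * py b) ×
  ((s + t) * pz p ≡ s * pz a + t * pz b)

-- p lies on the closed segment [a,b] (lattice point p: the parameter is rational).
OnSegment : ∀ {m} → Point m → Point m → Point m → Set
OnSegment a b p = ∃[ s ] ∃[ t ] (1 ≤ s + t × Comb s t a b p)

-- The open segments (a,b) and (c,d) share a common point.  Such a common
-- point can always be taken rational, so it is written as
-- (s a + t b)/(s+t) = (s' c + t' d)/(s'+t') with s,t,s',t' ≥ 1.
ShareInteriorPoint : ∀ {m} → Point m → Point m → Point m → Point m → Set
ShareInteriorPoint a b c d =
  ∃[ s ] ∃[ t ] ∃[ s' ] ∃[ t' ] (1 ≤ s × 1 ≤ t × 1 ≤ s' × 1 ≤ t' ×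
    ((s' + t') * (s * px a + t * px b) ≡ (s + t) * (s' * px c + t' * px d)) ×
    ((s' + t') * (s * py a + t * py b) ≡ (s + t) * (s' * py c + t' * py d)) ×
    ((s' + t') * (s * pz a + t * pz b) ≡ (s + t) * (s' * pz c + t' * pz d)))

record GridDrawing {n k : ℕ} (G : Graph n k) (m : ℕ) : Set where
  field
    pos       : Fin n → Point m
    injective : ∀ u v → pos u ≡ pos v → u ≡ v
    noVertexOnEdge : ∀ (e : Fin k) (v : Fin n) →
      v ≢ proj₁ (edge G e) → v ≢ proj₂ (edge G e) →
      OnSegment (pos (proj₁ (edge G e))) (pos (proj₂ (edge G e))) (pos v) →
      ⊥
    noCrossing : ∀ (e f : Fin k) → e ≢ f →
      ShareInteriorPoint (pos (proj₁ (edge G e))) (pos (proj₂ (edge G e)))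
                         (pos (proj₁ (edge G f))) (pos (proj₂ (edge G f))) →
      ⊥

{-# OPTIONS --safe #-}

-- First moment method. Place all vertices, and two auxiliary ones, independently and uniformly
-- in [M]³, where M is a power of two with M³ of order k² log k. Four points are coplanar when
-- one primitive relation N ∈ ℤ³ annihilates, in each of the three coordinates, the differences
-- between the first three points and the fourth. If the lattice orthogonal to N contains two
-- independent vectors of norm at most M, the relation has O(M³ / ‖N‖) solutions in [M]⁴, so it
-- holds in all three coordinates with probability O(M⁻³ ‖N‖⁻³). There are O(8ʲ) relations with
-- ‖N‖ about 2ʲ, and only O(log M) values of j matter since ‖N‖ ≤ 2M². Hence one quadruple is bad
-- with probability O(M⁻³ log M), and some placement avoids all O(k²) quadruples attached to
-- pairs of edges. There, no edge degenerates, no endpoint of an edge is collinear with another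
-- edge, and disjoint edges are not coplanar; isolated vertices are moved away from the cube.
module Submission where

open import Defs
open import Data.Nat using (ℕ; _+_; _*_; _^_; _≤_)
open import Data.Nat.Logarithm using (⌈log₂_⌉)
open import Data.Product using (Σ)
open import Data.Empty using (⊥)
open import Data.Fin using (Fin; zero; suc; toℕ; fromℕ<; inject₁; inject≤; remQuot; combine; _↑ʳ_; cast)
import Data.Fin as Fin
import Data.Fin.Properties as Fin
open import Data.Integer using (ℤ; +_; -[1+_]; ∣_∣; 0ℤ; 1ℤ)
  renaming (_+_ to _+ᶻ_; _*_ to _*ᶻ_; _-_ to _-ᶻ_; -_ to -ᶻ_)
import Data.Integer as ℤ
import Data.Integer.Properties as ℤ
import Data.Integer.Tactic.RingSolver as ℤSolver
open import Data.List
  using (List; []; _∷_; _++_; map; length; filter; upTo; allFin; cartesianProduct; cartesianProductWith)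
import Data.List as List
open import Data.List.Membership.Propositional using (_∈_)
open import Data.List.Membership.Propositional.Properties
  using (∈-lookup; ∈-filter⁺; ∈-filter⁻; ∈-upTo⁺; ∈-++⁺ˡ; ∈-++⁺ʳ; ∈-map⁺; ∈-cartesianProduct⁺;
         ∈-cartesianProductWith⁺; ∈-allFin)
open import Data.List.Properties using (map-cong; length-++; length-map; length-upTo; length-filter; length-tabulate)
import Data.List.Relation.Unary.All as All
open import Data.List.Relation.Unary.AllPairs using () renaming ([] to []ᵖ; _∷_ to _∷ᵖ_)
open import Data.List.Relation.Unary.Any using (here; there)
open import Data.List.Relation.Unary.Unique.Propositional using (Unique)
open import Data.List.Relation.Unary.Unique.Propositional.Properties
  using (filter⁺; allFin⁺; cartesianProductWith⁺)
open import Data.Nat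
  using (zero; suc; _∸_; _<_; _⊔_; z≤n; s≤s; _≤?_; ⌈_/2⌉; ⌊_/2⌋; NonZero; >-nonZero; >-nonZero⁻¹)
open import Data.Nat.Divisibility using (divides)
open import Data.Nat.DivMod
  using (_/_; _%_; m≡m%n+[m/n]*n; m%n<n; m*n/n≡m; m/n*n≤m; /-monoˡ-≤; m≥n⇒m/n>0)
open import Data.Nat.GCD using (module GCD; module Bézout)
open import Data.Nat.Induction using (<-rec)
open import Data.Nat.ListAction using (sum)
open import Data.Nat.Logarithm using (⌈log₂⌈n/2⌉⌉≡⌈log₂n⌉∸1; ⌈log₂⌉-mono-≤)
open import Data.Nat.Properties
open import Data.Nat.Tactic.RingSolver using (solve-∀)
open import Data.Product using (∃-syntax; _×_; _,_; proj₁; proj₂)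
import Data.Product.Properties as Product
open import Data.Sum using (_⊎_; inj₁; inj₂; [_,_]′)
open import Data.Unit using (tt)
open import Data.Vec using (Vec; []; _∷_; lookup; _[_]≔_)
import Data.Vec as Vec
open import Data.Vec.Properties using (lookup∘update; lookup∘update′; ∷-injective)
import Data.Vec.Relation.Unary.All as VAll
open import Data.Vec.Relation.Unary.AllPairs using ([]; _∷_; allPairs?)
open import Data.Vec.Relation.Unary.Unique.Propositional using () renaming (Unique to UniqueVec)
open import Function using (_∘_; id)
open import Relation.Binary using (DecidableEquality)
open import Relation.Binary.PropositionalEquality hiding (J)
open import Relation.Nullary using (¬_; Dec; yes; no; contradiction; ¬?)
open import Relation.Nullary.Decidable using (decidable-stable; _⊎-dec_)
open import Relation.Unary using (Pred; Decidable)

-- The count O(M³ / ‖N‖) can fail when the plane orthogonal to N has too few short lattice vectors,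
-- so every relation is presented through `e ⨯ f` with `e` and `f` of norm at most M. For four
-- coplanar points that are not collinear, two nonparallel columns of coordinate differences serve
-- as `e` and `f`. Collinear points have parallel columns and supply no such pair. An auxiliary
-- vertex of weight 0 remedies this: a relation among three points alone is orthogonal to (1, 1, 1),
-- which pairs with any column that is not a multiple of it. Coincident endpoints are excluded by
-- the single relation (1, -1, 0), with both auxiliary vertices. Each exclusion thus rests on the
-- previous one: coincidence, collinearity, coplanarity.
--
-- Every non-isolated vertex lies on some edge, so all incidences to be avoided are indexed by pairs
-- of edges, and the union bound involves k alone. The logarithm arises because the number of
-- relations at scale 2ʲ cancels against their probability, so that each scale costs the same. The
-- term `n * k` pays for the room outside the cube.

private variable
  A B C : Set

-- Finite sums and counting

∑ : List A → (A → ℕ) → ℕ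
∑ xs f = sum (map f xs)

∑-cong : (xs : List A) {f g : A → ℕ} → (∀ x → f x ≡ g x) → ∑ xs f ≡ ∑ xs g
∑-cong xs eq = cong sum (map-cong eq xs)

∑-+ : (xs : List A) (f g : A → ℕ) → ∑ xs (λ x → f x + g x) ≡ ∑ xs f + ∑ xs g
∑-+ []       f g = refl
∑-+ (x ∷ xs) f g rewrite ∑-+ xs f g = shuffle (f x) (g x) (∑ xs f) (∑ xs g)
  where
  shuffle : ∀ a b c d → a + b + (c + d) ≡ a + c + (b + d)
  shuffle = solve-∀

∑-*ʳ : (xs : List A) (f : A → ℕ) (c : ℕ) → ∑ xs (λ x → f x * c) ≡ ∑ xs f * c
∑-*ʳ []       f c = refl
∑-*ʳ (x ∷ xs) f c rewrite ∑-*ʳ xs f c = sym (*-distribʳ-+ c (f x) (∑ xs f))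

∑-*ˡ : (xs : List A) (f : A → ℕ) (c : ℕ) → ∑ xs (λ x → c * f x) ≡ c * ∑ xs f
∑-*ˡ xs f c = begin
  ∑ xs (λ x → c * f x) ≡⟨ ∑-cong xs (λ x → *-comm c (f x)) ⟩
  ∑ xs (λ x → f x * c) ≡⟨ ∑-*ʳ xs f c ⟩
  ∑ xs f * c           ≡⟨ *-comm (∑ xs f) c ⟩
  c * ∑ xs f           ∎
  where open ≡-Reasoning

∑-const : (xs : List A) (c : ℕ) → ∑ xs (λ _ → c) ≡ length xs * c
∑-const []       c = refl
∑-const (x ∷ xs) c = cong (λ z → c + z) (∑-const xs c)

∑-swap : (xs : List A) (ys : List B) (f : A → B → ℕ) →
  ∑ xs (λ x → ∑ ys (f x)) ≡ ∑ ys (λ y → ∑ xs (λ x → f x y))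
∑-swap []       ys f = sym (trans (∑-const ys 0) (*-zeroʳ (length ys)))
∑-swap (x ∷ xs) ys f = begin
  ∑ ys (f x) + ∑ xs (λ x → ∑ ys (f x))               ≡⟨ cong (λ z → ∑ ys (f x) + z) (∑-swap xs ys f) ⟩
  ∑ ys (f x) + ∑ ys (λ y → ∑ xs (λ x → f x y))       ≡⟨ ∑-+ ys (f x) _ ⟨
  ∑ ys (λ y → f x y + ∑ xs (λ x → f x y))            ∎
  where open ≡-Reasoning

∑-++ : (xs ys : List A) (f : A → ℕ) → ∑ (xs ++ ys) f ≡ ∑ xs f + ∑ ys f
∑-++ []       ys f = refl
∑-++ (x ∷ xs) ys f rewrite ∑-++ xs ys f = sym (+-assoc (f x) (∑ xs f) (∑ ys f))

∑-map : (g : A → B) (xs : List A) (f : B → ℕ) → ∑ (map g xs) f ≡ ∑ xs (f ∘ g)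
∑-map g []       f = refl
∑-map g (x ∷ xs) f = cong (λ z → f (g x) + z) (∑-map g xs f)

∑-cartesianProductWith : (g : A → B → C) (xs : List A) (ys : List B) (f : C → ℕ) →
  ∑ (cartesianProductWith g xs ys) f ≡ ∑ xs (λ x → ∑ ys (λ y → f (g x y)))
∑-cartesianProductWith g []       ys f = refl
∑-cartesianProductWith g (x ∷ xs) ys f =
  trans (∑-++ (map (g x) ys) (cartesianProductWith g xs ys) f)
        (cong₂ _+_ (∑-map (g x) ys f) (∑-cartesianProductWith g xs ys f))

-- A union bound with the denominator `c` cleared: all probabilities below are kept in this form, so
-- no fractions occur.
∑-≤-length : (xs : List A) (f : A → ℕ) (c b : ℕ) → (∀ {x} → x ∈ xs → f x * c ≤ b) →
  ∑ xs f * c ≤ length xs * b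
∑-≤-length []       f c b h = z≤n
∑-≤-length (x ∷ xs) f c b h = begin
  (f x + ∑ xs f) * c       ≡⟨ *-distribʳ-+ c (f x) (∑ xs f) ⟩
  f x * c + ∑ xs f * c     ≤⟨ +-mono-≤ (h (here refl)) (∑-≤-length xs f c b (h ∘ there)) ⟩
  b + length xs * b        ∎
  where open ≤-Reasoning

∑≡0⇒≡0 : (xs : List A) (f : A → ℕ) → ∑ xs f ≡ 0 → ∀ {x} → x ∈ xs → f x ≡ 0
∑≡0⇒≡0 (x ∷ xs) f eq (here refl)  = m+n≡0⇒m≡0 (f x) eq
∑≡0⇒≡0 (x ∷ xs) f eq (there x∈xs) = ∑≡0⇒≡0 xs f (m+n≡0⇒n≡0 (f x) eq) x∈xs

-- The first moment principle: if every value were at least 1, the sum would reach the length.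
∑<length⇒∃≡0 : (xs : List A) (f : A → ℕ) → ∑ xs f < length xs → ∃[ x ] f x ≡ 0
∑<length⇒∃≡0 (x ∷ xs) f lt with f x in eq
... | zero  = x , eq
... | suc n = ∑<length⇒∃≡0 xs f (≤-<-trans (m≤n+m (∑ xs f) n) (≤-pred lt))

length-cartesianProductWith : (g : A → B → C) (xs : List A) (ys : List B) →
  length (cartesianProductWith g xs ys) ≡ length xs * length ys
length-cartesianProductWith g []       ys = refl
length-cartesianProductWith g (x ∷ xs) ys = begin
  length (map (g x) ys ++ cartesianProductWith g xs ys)
    ≡⟨ length-++ (map (g x) ys) ⟩
  length (map (g x) ys) + length (cartesianProductWith g xs ys)
    ≡⟨ cong₂ _+_ (length-map (g x) ys) (length-cartesianProductWith g xs ys) ⟩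
  length ys + length xs * length ys ∎
  where open ≡-Reasoning

ind : {P : Set} → Dec P → ℕ
ind (yes _) = 1
ind (no  _) = 0

ind-yes : {P : Set} (d : Dec P) → P → ind d ≡ 1
ind-yes (yes _) _ = refl
ind-yes (no ¬p) p = contradiction p ¬p

∑-ind : {P : Pred A _} (P? : Decidable P) (xs : List A) →
  ∑ xs (λ x → ind (P? x)) ≡ length (filter P? xs)
∑-ind P? []       = refl
∑-ind P? (x ∷ xs) with P? x
... | yes _ = cong suc (∑-ind P? xs)
... | no  _ = ∑-ind P? xs

lookup-injective : {xs : List A} → Unique xs →
  ∀ i j → List.lookup xs i ≡ List.lookup xs j → i ≡ j
lookup-injective (_   ∷ᵖ _)  zero    zero    _  = refl
lookup-injective (x∉ ∷ᵖ _)  zero    (suc j) eq = contradiction eq (All.lookup x∉ (∈-lookup j))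
lookup-injective (x∉ ∷ᵖ _)  (suc i) zero    eq = contradiction (sym eq) (All.lookup x∉ (∈-lookup i))
lookup-injective (_   ∷ᵖ u)  (suc i) (suc j) eq = cong suc (lookup-injective u i j eq)

-- The key is only asked of elements satisfying `P`, since in the application the proof of `P` is
-- what bounds its range.
∑-ind-≤ : {P : Pred A _} (P? : Decidable P) {xs : List A} → Unique xs →
  {K : ℕ} (key : ∀ {x} → P x → Fin K) →
  (∀ {x y} (p : P x) (q : P y) → key p ≡ key q → x ≡ y) →
  ∑ xs (λ x → ind (P? x)) ≤ K
∑-ind-≤ P? {xs} u key key-inj = subst (_≤ _) (sym (∑-ind P? xs))
  (Fin.injective⇒≤ {f = λ i → key (sat i)} λ {i} {j} eq →
    lookup-injective (filter⁺ P? u) i j (key-inj (sat i) (sat j) eq))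
  where
  sols = filter P? xs
  sat : ∀ i → _
  sat i = proj₂ (∈-filter⁻ P? {xs = xs} (∈-lookup {xs = sols} i))

-- Uniform random vectors and independence of their coordinates

module _ (M : ℕ) where

  vecs : ∀ n → List (Vec (Fin M) n)
  vecs zero    = [] ∷ []
  vecs (suc n) = cartesianProductWith _∷_ (allFin M) (vecs n)

  vecs-unique : ∀ n → Unique (vecs n)
  vecs-unique zero    = All.[] ∷ᵖ []ᵖ
  vecs-unique (suc n) = cartesianProductWith⁺ _∷_ ∷-injective (allFin⁺ M) (vecs-unique n)

  length-vecs : ∀ n → length (vecs n) ≡ M ^ n
  length-vecs zero    = refl
  length-vecs (suc n) = trans (length-cartesianProductWith _∷_ (allFin M) (vecs n))
    (cong₂ _*_ (length-tabulate {n = M} id) (length-vecs n))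

  -- Every vector arises from exactly `M` pairs `(X , p)`, one for each overwritten value at `i`:
  -- redrawing a coordinate preserves the uniform distribution.
  ∑-resample : ∀ {n} (i : Fin n) (F : Vec (Fin M) n → ℕ) →
    ∑ (vecs n) (λ X → ∑ (allFin M) (λ p → F (X [ i ]≔ p))) ≡ M * ∑ (vecs n) F
  ∑-resample {suc n} zero F = begin
    ∑ (vecs (suc n)) (λ X → ∑ (allFin M) (λ p → F (X [ zero ]≔ p)))
      ≡⟨ ∑-cartesianProductWith _∷_ (allFin M) (vecs n) _ ⟩
    ∑ (allFin M) (λ _ → ∑ (vecs n) (λ X → ∑ (allFin M) (λ p → F (p ∷ X))))
      ≡⟨ ∑-const (allFin M) _ ⟩
    length (allFin M) * ∑ (vecs n) (λ X → ∑ (allFin M) (λ p → F (p ∷ X)))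
      ≡⟨ cong₂ _*_ (length-tabulate {n = M} id) (∑-swap (vecs n) (allFin M) (λ X p → F (p ∷ X))) ⟩
    M * ∑ (allFin M) (λ p → ∑ (vecs n) (λ X → F (p ∷ X)))
      ≡⟨ cong (M *_) (∑-cartesianProductWith _∷_ (allFin M) (vecs n) F) ⟨
    M * ∑ (vecs (suc n)) F ∎
    where open ≡-Reasoning
  ∑-resample {suc n} (suc i) F = begin
    ∑ (vecs (suc n)) (λ X → ∑ (allFin M) (λ p → F (X [ suc i ]≔ p)))
      ≡⟨ ∑-cartesianProductWith _∷_ (allFin M) (vecs n) _ ⟩
    ∑ (allFin M) (λ q → ∑ (vecs n) (λ X → ∑ (allFin M) (λ p → F (q ∷ (X [ i ]≔ p)))))
      ≡⟨ ∑-cong (allFin M) (λ q → ∑-resample i (λ X → F (q ∷ X))) ⟩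
    ∑ (allFin M) (λ q → M * ∑ (vecs n) (λ X → F (q ∷ X)))
      ≡⟨ ∑-*ˡ (allFin M) _ M ⟩
    M * ∑ (allFin M) (λ q → ∑ (vecs n) (λ X → F (q ∷ X)))
      ≡⟨ cong (M *_) (∑-cartesianProductWith _∷_ (allFin M) (vecs n) F) ⟨
    M * ∑ (vecs (suc n)) F ∎
    where open ≡-Reasoning

pick : ∀ {n d} → Vec A n → Vec (Fin n) d → Vec A d
pick X = Vec.map (lookup X)

pick-update : ∀ {n d} (X : Vec A n) (i : Fin n) (p : A) (q : Vec (Fin n) d) →
  VAll.All (i ≢_) q → pick (X [ i ]≔ p) q ≡ pick X q
pick-update X i p []      VAll.[]            = refl
pick-update X i p (j ∷ q) (i≢j VAll.∷ i∉q) =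
  cong₂ _∷_ (lookup∘update′ (i≢j ∘ sym) X p) (pick-update X i p q i∉q)

-- Distinct coordinates of a uniformly random vector are independent and uniform.
∑-pick : ∀ M {n d} (q : Vec (Fin n) d) → UniqueVec q → (φ : Vec (Fin M) d → ℕ) →
  M ^ d * ∑ (vecs M n) (λ X → φ (pick X q)) ≡ M ^ n * ∑ (vecs M d) φ
∑-pick M {n} [] _ φ = begin
  1 * ∑ (vecs M n) (λ _ → φ [])  ≡⟨ *-identityˡ _ ⟩
  ∑ (vecs M n) (λ _ → φ [])      ≡⟨ ∑-const (vecs M n) (φ []) ⟩
  length (vecs M n) * φ []       ≡⟨ cong₂ _*_ (length-vecs M n) (sym (+-identityʳ (φ []))) ⟩
  M ^ n * (φ [] + 0)             ∎
  where open ≡-Reasoning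
∑-pick M {n} {suc d} (i ∷ q) (i∉q ∷ u) φ = begin
  M * M ^ d * ∑ (vecs M n) F
    ≡⟨ reassoc M (M ^ d) _ ⟩
  M ^ d * (M * ∑ (vecs M n) F)
    ≡⟨ cong (M ^ d *_) (∑-resample M i F) ⟨
  M ^ d * ∑ (vecs M n) (λ X → ∑ (allFin M) (λ p → F (X [ i ]≔ p)))
    ≡⟨ cong (M ^ d *_) (∑-cong (vecs M n) λ X → ∑-cong (allFin M) λ p → cong φ
         (cong₂ _∷_ (lookup∘update i X p) (pick-update X i p q i∉q))) ⟩
  M ^ d * ∑ (vecs M n) (λ X → ∑ (allFin M) (λ p → φ (p ∷ pick X q)))
    ≡⟨ cong (M ^ d *_) (∑-swap (vecs M n) (allFin M) _) ⟩
  M ^ d * ∑ (allFin M) (λ p → ∑ (vecs M n) (λ X → φ (p ∷ pick X q)))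
    ≡⟨ ∑-*ˡ (allFin M) _ (M ^ d) ⟨
  ∑ (allFin M) (λ p → M ^ d * ∑ (vecs M n) (λ X → φ (p ∷ pick X q)))
    ≡⟨ ∑-cong (allFin M) (λ p → ∑-pick M q u (λ y → φ (p ∷ y))) ⟩
  ∑ (allFin M) (λ p → M ^ n * ∑ (vecs M d) (λ y → φ (p ∷ y)))
    ≡⟨ ∑-*ˡ (allFin M) _ (M ^ n) ⟩
  M ^ n * ∑ (allFin M) (λ p → ∑ (vecs M d) (λ y → φ (p ∷ y)))
    ≡⟨ cong (M ^ n *_) (∑-cartesianProductWith _∷_ (allFin M) (vecs M d) φ) ⟨
  M ^ n * ∑ (vecs M (suc d)) φ ∎
  where
  open ≡-Reasoning
  F : Vec (Fin M) n → ℕ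
  F X = φ (pick X (i ∷ q))
  reassoc : ∀ a b c → a * b * c ≡ b * (a * c)
  reassoc = solve-∀

-- Vector algebra over the integers and primitive vectors

ℤ³ : Set
ℤ³ = ℤ × ℤ × ℤ

infixl 7 _∙_
infixl 8 _⨯_ _•_
infixl 6 _⊝_

_∙_ : ℤ³ → ℤ³ → ℤ
(a , b , c) ∙ (d , e , f) = a *ᶻ d +ᶻ b *ᶻ e +ᶻ c *ᶻ f

_⨯_ : ℤ³ → ℤ³ → ℤ³
(a , b , c) ⨯ (d , e , f) = b *ᶻ f -ᶻ c *ᶻ e , c *ᶻ d -ᶻ a *ᶻ f , a *ᶻ e -ᶻ b *ᶻ d

_•_ : ℤ → ℤ³ → ℤ³
t • (a , b , c) = t *ᶻ a , t *ᶻ b , t *ᶻ c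

_⊝_ : ℤ³ → ℤ³ → ℤ³
(a , b , c) ⊝ (d , e , f) = a -ᶻ d , b -ᶻ e , c -ᶻ f

𝟎 : ℤ³
𝟎 = 0ℤ , 0ℤ , 0ℤ

triple-≡ : ∀ {a b c a′ b′ c′ : ℤ} → a ≡ a′ → b ≡ b′ → c ≡ c′ → (a , b , c) ≡ (a′ , b′ , c′)
triple-≡ refl refl refl = refl

•-∙ : ∀ t u v → (t • u) ∙ v ≡ t *ᶻ (u ∙ v)
•-∙ t (a , b , c) (d , e , f) = identity t a b c d e f
  where
  identity : ∀ t a b c d e f →
    t *ᶻ a *ᶻ d +ᶻ t *ᶻ b *ᶻ e +ᶻ t *ᶻ c *ᶻ f ≡ t *ᶻ (a *ᶻ d +ᶻ b *ᶻ e +ᶻ c *ᶻ f)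
  identity = ℤSolver.solve-∀

∙-comm : ∀ u v → u ∙ v ≡ v ∙ u
∙-comm (a , b , c) (d , e , f) =
  cong₂ _+ᶻ_ (cong₂ _+ᶻ_ (ℤ.*-comm a d) (ℤ.*-comm b e)) (ℤ.*-comm c f)

•-⨯ : ∀ t u v → (t • u) ⨯ v ≡ t • (u ⨯ v)
•-⨯ t (a , b , c) (d , e , f) = triple-≡ (identity t b c e f) (identity t c a f d) (identity t a b d e)
  where
  identity : ∀ t b c e f → t *ᶻ b *ᶻ f -ᶻ t *ᶻ c *ᶻ e ≡ t *ᶻ (b *ᶻ f -ᶻ c *ᶻ e)
  identity = ℤSolver.solve-∀

•-zeroʳ : ∀ t → t • 𝟎 ≡ 𝟎
•-zeroʳ t = triple-≡ (ℤ.*-zeroʳ t) (ℤ.*-zeroʳ t) (ℤ.*-zeroʳ t)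

•-zeroˡ : ∀ v → 0ℤ • v ≡ 𝟎
•-zeroˡ _ = refl

⨯-⊝ : ∀ u v w → u ⨯ (v ⊝ w) ≡ u ⨯ v ⊝ u ⨯ w
⨯-⊝ (a , b , c) (d , e , f) (g , h , i) =
  triple-≡ (identity b c e f h i) (identity c a f d i g) (identity a b d e g h)
  where
  identity : ∀ b c e f h i →
    b *ᶻ (f -ᶻ i) -ᶻ c *ᶻ (e -ᶻ h) ≡ (b *ᶻ f -ᶻ c *ᶻ e) -ᶻ (b *ᶻ i -ᶻ c *ᶻ h)
  identity = ℤSolver.solve-∀

u⊝u≡𝟎 : ∀ u → u ⊝ u ≡ 𝟎
u⊝u≡𝟎 (a , b , c) = triple-≡ (ℤ.+-inverseʳ a) (ℤ.+-inverseʳ b) (ℤ.+-inverseʳ c)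

⨯-∙ˡ : ∀ u v → (u ⨯ v) ∙ u ≡ 0ℤ
⨯-∙ˡ (a , b , c) (d , e , f) = identity a b c d e f
  where
  identity : ∀ a b c d e f →
    (b *ᶻ f -ᶻ c *ᶻ e) *ᶻ a +ᶻ (c *ᶻ d -ᶻ a *ᶻ f) *ᶻ b +ᶻ (a *ᶻ e -ᶻ b *ᶻ d) *ᶻ c ≡ 0ℤ
  identity = ℤSolver.solve-∀

⨯-∙ʳ : ∀ u v → (u ⨯ v) ∙ v ≡ 0ℤ
⨯-∙ʳ (a , b , c) (d , e , f) = identity a b c d e f
  where
  identity : ∀ a b c d e f →
    (b *ᶻ f -ᶻ c *ᶻ e) *ᶻ d +ᶻ (c *ᶻ d -ᶻ a *ᶻ f) *ᶻ e +ᶻ (a *ᶻ e -ᶻ b *ᶻ d) *ᶻ f ≡ 0ℤ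
  identity = ℤSolver.solve-∀

∙-𝟎 : ∀ u → u ∙ 𝟎 ≡ 0ℤ
∙-𝟎 (a , b , c) rewrite ℤ.*-zeroʳ a | ℤ.*-zeroʳ b | ℤ.*-zeroʳ c = refl

-- The expansion n ⨯ (u ⨯ v) = (n ∙ v) u - (n ∙ u) v, coordinate by coordinate.
⊥⇒⨯⨯≡𝟎 : ∀ n u v → n ∙ u ≡ 0ℤ → n ∙ v ≡ 0ℤ → n ⨯ (u ⨯ v) ≡ 𝟎
⊥⇒⨯⨯≡𝟎 (n , m , k) (a , b , c) (d , e , f) nu nv = triple-≡
  (trans (identity₁ n m k a b c d e f) (vanish a d))
  (trans (identity₂ n m k a b c d e f) (vanish b e))
  (trans (identity₃ n m k a b c d e f) (vanish c f))
  where
  s = n *ᶻ a +ᶻ m *ᶻ b +ᶻ k *ᶻ c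
  t = n *ᶻ d +ᶻ m *ᶻ e +ᶻ k *ᶻ f
  vanish : ∀ x y → t *ᶻ x -ᶻ s *ᶻ y ≡ 0ℤ
  vanish x y rewrite nu | nv = refl
  identity₁ : ∀ n m k a b c d e f →
    m *ᶻ (a *ᶻ e -ᶻ b *ᶻ d) -ᶻ k *ᶻ (c *ᶻ d -ᶻ a *ᶻ f) ≡
    (n *ᶻ d +ᶻ m *ᶻ e +ᶻ k *ᶻ f) *ᶻ a -ᶻ (n *ᶻ a +ᶻ m *ᶻ b +ᶻ k *ᶻ c) *ᶻ d
  identity₁ = ℤSolver.solve-∀
  identity₂ : ∀ n m k a b c d e f →
    k *ᶻ (b *ᶻ f -ᶻ c *ᶻ e) -ᶻ n *ᶻ (a *ᶻ e -ᶻ b *ᶻ d) ≡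
    (n *ᶻ d +ᶻ m *ᶻ e +ᶻ k *ᶻ f) *ᶻ b -ᶻ (n *ᶻ a +ᶻ m *ᶻ b +ᶻ k *ᶻ c) *ᶻ e
  identity₂ = ℤSolver.solve-∀
  identity₃ : ∀ n m k a b c d e f →
    n *ᶻ (c *ᶻ d -ᶻ a *ᶻ f) -ᶻ m *ᶻ (b *ᶻ f -ᶻ c *ᶻ e) ≡
    (n *ᶻ d +ᶻ m *ᶻ e +ᶻ k *ᶻ f) *ᶻ c -ᶻ (n *ᶻ a +ᶻ m *ᶻ b +ᶻ k *ᶻ c) *ᶻ f
  identity₃ = ℤSolver.solve-∀

Primitive : ℤ³ → Set
Primitive v = ∃[ p ] p ∙ v ≡ 1ℤ

-- By Bézout, the coefficient of a multiple of a primitive vector is an integer.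
parallel⇒multiple : ∀ v w ((p , _) : Primitive v) → v ⨯ w ≡ 𝟎 → w ≡ (p ∙ w) • v
parallel⇒multiple (a , b , c) (d , e , f) ((p , q , r) , pv≡1) v⨯w≡𝟎 = triple-≡
  (reduce (identity₁ a b c d e f p q r) (cong₂ _-ᶻ_ (cong (r *ᶻ_) eq₂) (cong (q *ᶻ_) eq₃)) (zeros r q))
  (reduce (identity₂ a b c d e f p q r) (cong₂ _-ᶻ_ (cong (p *ᶻ_) eq₃) (cong (r *ᶻ_) eq₁)) (zeros p r))
  (reduce (identity₃ a b c d e f p q r) (cong₂ _-ᶻ_ (cong (q *ᶻ_) eq₁) (cong (p *ᶻ_) eq₂)) (zeros q p))
  where
  eq₁ = cong proj₁ v⨯w≡𝟎
  eq₂ = cong (proj₁ ∘ proj₂) v⨯w≡𝟎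
  eq₃ = cong (proj₂ ∘ proj₂) v⨯w≡𝟎
  zeros : ∀ x y → x *ᶻ 0ℤ -ᶻ y *ᶻ 0ℤ ≡ 0ℤ
  zeros x y rewrite ℤ.*-zeroʳ x | ℤ.*-zeroʳ y = refl
  reduce : ∀ {x y s t} → (p *ᶻ a +ᶻ q *ᶻ b +ᶻ r *ᶻ c) *ᶻ x ≡ y +ᶻ s → s ≡ t → t ≡ 0ℤ → x ≡ y
  reduce {x} {y} h refl refl =
    trans (sym (ℤ.*-identityˡ x)) (trans (cong (_*ᶻ x) (sym pv≡1)) (trans h (ℤ.+-identityʳ y)))
  identity₁ : ∀ a b c d e f p q r →
    (p *ᶻ a +ᶻ q *ᶻ b +ᶻ r *ᶻ c) *ᶻ d ≡
    (p *ᶻ d +ᶻ q *ᶻ e +ᶻ r *ᶻ f) *ᶻ a +ᶻ (r *ᶻ (c *ᶻ d -ᶻ a *ᶻ f) -ᶻ q *ᶻ (a *ᶻ e -ᶻ b *ᶻ d))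
  identity₁ = ℤSolver.solve-∀
  identity₂ : ∀ a b c d e f p q r →
    (p *ᶻ a +ᶻ q *ᶻ b +ᶻ r *ᶻ c) *ᶻ e ≡
    (p *ᶻ d +ᶻ q *ᶻ e +ᶻ r *ᶻ f) *ᶻ b +ᶻ (p *ᶻ (a *ᶻ e -ᶻ b *ᶻ d) -ᶻ r *ᶻ (b *ᶻ f -ᶻ c *ᶻ e))
  identity₂ = ℤSolver.solve-∀
  identity₃ : ∀ a b c d e f p q r →
    (p *ᶻ a +ᶻ q *ᶻ b +ᶻ r *ᶻ c) *ᶻ f ≡
    (p *ᶻ d +ᶻ q *ᶻ e +ᶻ r *ᶻ f) *ᶻ c +ᶻ (q *ᶻ (b *ᶻ f -ᶻ c *ᶻ e) -ᶻ p *ᶻ (c *ᶻ d -ᶻ a *ᶻ f))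
  identity₃ = ℤSolver.solve-∀

unsigned : ∀ a → ∃[ σ ] (+ ∣ a ∣ ≡ σ *ᶻ a × a ≡ σ *ᶻ + ∣ a ∣)
unsigned (+ n)      = 1ℤ , sym (ℤ.*-identityˡ (+ n)) , sym (ℤ.*-identityˡ (+ n))
unsigned -[1+ n ]   = -[1+ 0 ] , sym (ℤ.-1*i≡-i -[1+ n ]) , sym (ℤ.-1*i≡-i (+ suc n))

bézout : ∀ a b → ∃[ d ] ∃[ a′ ] ∃[ b′ ] ∃[ p ] ∃[ q ]
  (a ≡ d *ᶻ a′ × b ≡ d *ᶻ b′ × d ≡ p *ᶻ a +ᶻ q *ᶻ b)
bézout a b
  with σ , |a|≡σa , a≡σ|a| ← unsigned a | τ , |b|≡τb , b≡τ|b| ← unsigned b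
  with Bézout.result d g i ← Bézout.lemma ∣ a ∣ ∣ b ∣
  with divides a″ eqa ← GCD.gcd∣m g | divides b″ eqb ← GCD.gcd∣n g = combination i
  where
  quotient : ∀ {x y} ρ z → x ≡ ρ *ᶻ + y → y ≡ z * d → x ≡ + d *ᶻ (ρ *ᶻ + z)
  quotient ρ z refl refl = trans (cong (ρ *ᶻ_) (ℤ.pos-* z d)) (reorder ρ (+ z) (+ d))
    where
    reorder : ∀ ρ z d → ρ *ᶻ (z *ᶻ d) ≡ d *ᶻ (ρ *ᶻ z)
    reorder = ℤSolver.solve-∀
  isolate : ∀ x m y n → d + y * n ≡ x * m → + d ≡ + x *ᶻ + m -ᶻ + y *ᶻ + n
  isolate x m y n eq = begin
    + d                                   ≡⟨ cancel (+ d) (+ y *ᶻ + n) ⟩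
    (+ d +ᶻ + y *ᶻ + n) -ᶻ + y *ᶻ + n      ≡⟨ cong (λ z → (+ d +ᶻ z) -ᶻ + y *ᶻ + n) (ℤ.pos-* y n) ⟨
    + (d + y * n) -ᶻ + y *ᶻ + n           ≡⟨ cong (λ z → + z -ᶻ + y *ᶻ + n) eq ⟩
    + (x * m) -ᶻ + y *ᶻ + n               ≡⟨ cong (_-ᶻ + y *ᶻ + n) (ℤ.pos-* x m) ⟩
    + x *ᶻ + m -ᶻ + y *ᶻ + n              ∎
    where
    open ≡-Reasoning
    cancel : ∀ i j → i ≡ (i +ᶻ j) -ᶻ j
    cancel = ℤSolver.solve-∀
  combination : Bézout.Identity d ∣ a ∣ ∣ b ∣ → _
  combination (Bézout.+- x y eq) =
    + d , _ , _ , + x *ᶻ σ , -ᶻ (+ y) *ᶻ τ , quotient σ a″ a≡σ|a| eqa , quotient τ b″ b≡τ|b| eqb ,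
    trans (isolate x (∣ a ∣) y (∣ b ∣) eq) (trans (cong₂ (λ m n → + x *ᶻ m -ᶻ + y *ᶻ n) |a|≡σa |b|≡τb)
      (reorder (+ x) σ a (+ y) τ b))
    where
    reorder : ∀ x σ a y τ b → x *ᶻ (σ *ᶻ a) -ᶻ y *ᶻ (τ *ᶻ b) ≡ x *ᶻ σ *ᶻ a +ᶻ -ᶻ y *ᶻ τ *ᶻ b
    reorder = ℤSolver.solve-∀
  combination (Bézout.-+ x y eq) =
    + d , _ , _ , -ᶻ (+ x) *ᶻ σ , + y *ᶻ τ , quotient σ a″ a≡σ|a| eqa , quotient τ b″ b≡τ|b| eqb ,
    trans (isolate y (∣ b ∣) x (∣ a ∣) eq) (trans (cong₂ (λ m n → + y *ᶻ n -ᶻ + x *ᶻ m) |a|≡σa |b|≡τb)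
      (reorder (+ x) σ a (+ y) τ b))
    where
    reorder : ∀ x σ a y τ b → y *ᶻ (τ *ᶻ b) -ᶻ x *ᶻ (σ *ᶻ a) ≡ -ᶻ x *ᶻ σ *ᶻ a +ᶻ y *ᶻ τ *ᶻ b
    reorder = ℤSolver.solve-∀

*-cancelˡ-≢0 : ∀ {t i j} → t ≢ 0ℤ → t *ᶻ i ≡ t *ᶻ j → i ≡ j
*-cancelˡ-≢0 {t} t≢0 = ℤ.*-cancelˡ-≡ t _ _ {{ℤ.≢-nonZero t≢0}}

*≡0⇒≡0 : ∀ {t i} → t ≢ 0ℤ → t *ᶻ i ≡ 0ℤ → i ≡ 0ℤ
*≡0⇒≡0 {t} t≢0 eq = *-cancelˡ-≢0 t≢0 (trans eq (sym (ℤ.*-zeroʳ t)))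

-- `D` is the gcd of the three entries, reached as the gcd of `d` (that of the first two) and the
-- third. Substituting one Bézout identity into the other and cancelling `D` yields the witness of
-- primitivity.
primitivePart : ∀ v → v ≢ 𝟎 → ∃[ g ] ∃[ v′ ] (v ≡ g • v′ × Primitive v′)
primitivePart (a , b , c) v≢𝟎
  with d , a′ , b′ , p , q , refl , refl , d≡ ← bézout a b
  with D , d′ , c′ , P , Q , refl , refl , D≡ ← bézout d c =
  D , (d′ *ᶻ a′ , d′ *ᶻ b′ , c′) , v≡ ,
  (P *ᶻ p , P *ᶻ q , Q) , *-cancelˡ-≢0 D≢0 (sym (begin
    D *ᶻ 1ℤ
      ≡⟨ ℤ.*-identityʳ D ⟩
    D
      ≡⟨ D≡ ⟩
    P *ᶻ (D *ᶻ d′) +ᶻ Q *ᶻ (D *ᶻ c′)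
      ≡⟨ cong (λ z → P *ᶻ z +ᶻ Q *ᶻ (D *ᶻ c′)) d≡ ⟩
    P *ᶻ (p *ᶻ (D *ᶻ d′ *ᶻ a′) +ᶻ q *ᶻ (D *ᶻ d′ *ᶻ b′)) +ᶻ Q *ᶻ (D *ᶻ c′)
      ≡⟨ reorder D d′ a′ b′ c′ p q P Q ⟩
    D *ᶻ (P *ᶻ p *ᶻ (d′ *ᶻ a′) +ᶻ P *ᶻ q *ᶻ (d′ *ᶻ b′) +ᶻ Q *ᶻ c′) ∎))
  where
  open ≡-Reasoning
  v≡ = triple-≡ (ℤ.*-assoc D d′ a′) (ℤ.*-assoc D d′ b′) refl
  D≢0 : D ≢ 0ℤ
  D≢0 refl = v≢𝟎 v≡
  reorder : ∀ D d′ a′ b′ c′ p q P Q →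
    P *ᶻ (p *ᶻ (D *ᶻ d′ *ᶻ a′) +ᶻ q *ᶻ (D *ᶻ d′ *ᶻ b′)) +ᶻ Q *ᶻ (D *ᶻ c′) ≡
    D *ᶻ (P *ᶻ p *ᶻ (d′ *ᶻ a′) +ᶻ P *ᶻ q *ᶻ (d′ *ᶻ b′) +ᶻ Q *ᶻ c′)
  reorder = ℤSolver.solve-∀

-- The maximum norm

‖_‖ : ℤ³ → ℕ
‖ a , b , c ‖ = ∣ a ∣ ⊔ (∣ b ∣ ⊔ ∣ c ∣)

coord : ℤ³ → Fin 3 → ℤ
coord (a , b , c) zero             = a
coord (a , b , c) (suc zero)       = b
coord (a , b , c) (suc (suc zero)) = c

∃coord≡‖‖ : ∀ v → ∃[ i ] ∣ coord v i ∣ ≡ ‖ v ‖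
∃coord≡‖‖ (a , b , c) with ⊔-sel ∣ a ∣ (∣ b ∣ ⊔ ∣ c ∣) | ⊔-sel ∣ b ∣ ∣ c ∣
... | inj₁ eq | _        = zero , sym eq
... | inj₂ eq | inj₁ eq′ = suc zero , sym (trans eq eq′)
... | inj₂ eq | inj₂ eq′ = suc (suc zero) , sym (trans eq eq′)

‖•‖ : ∀ t v → ‖ t • v ‖ ≡ ∣ t ∣ * ‖ v ‖
‖•‖ t (a , b , c) rewrite ℤ.abs-* t a | ℤ.abs-* t b | ℤ.abs-* t c =
  sym (trans (*-distribˡ-⊔ ∣ t ∣ ∣ a ∣ _) (cong ((∣ t ∣ * ∣ a ∣) ⊔_) (*-distribˡ-⊔ ∣ t ∣ ∣ b ∣ _)))

‖‖≡0⇒≡𝟎 : ∀ v → ‖ v ‖ ≡ 0 → v ≡ 𝟎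
‖‖≡0⇒≡𝟎 (a , b , c) eq = triple-≡
  (ℤ.∣i∣≡0⇒i≡0 (below (m≤m⊔n ∣ a ∣ _)))
  (ℤ.∣i∣≡0⇒i≡0 (below (≤-trans (m≤m⊔n ∣ b ∣ _) (m≤n⊔m ∣ a ∣ _))))
  (ℤ.∣i∣≡0⇒i≡0 (below (≤-trans (m≤n⊔m ∣ b ∣ _) (m≤n⊔m ∣ a ∣ _))))
  where
  below : ∀ {n} → n ≤ ‖ a , b , c ‖ → n ≡ 0
  below n≤ = n≤0⇒n≡0 (subst (_ ≤_) eq n≤)

‖‖-positive : ∀ {v} → v ≢ 𝟎 → 1 ≤ ‖ v ‖
‖‖-positive {v} v≢𝟎 = n≢0⇒n>0 (v≢𝟎 ∘ ‖‖≡0⇒≡𝟎 v)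

‖⨯‖ : ∀ u v → ‖ u ⨯ v ‖ ≤ 2 * (‖ u ‖ * ‖ v ‖)
‖⨯‖ (a , b , c) (d , e , f) =
  ⊔-lub (minor b f c e b≤ f≤ c≤ e≤) (⊔-lub (minor c d a f c≤ d≤ a≤ f≤) (minor a e b d a≤ e≤ b≤ d≤))
  where
  U = ‖ a , b , c ‖
  V = ‖ d , e , f ‖
  a≤ = m≤m⊔n ∣ a ∣ (∣ b ∣ ⊔ ∣ c ∣)
  b≤ = ≤-trans (m≤m⊔n ∣ b ∣ ∣ c ∣) (m≤n⊔m ∣ a ∣ _)
  c≤ = ≤-trans (m≤n⊔m ∣ b ∣ ∣ c ∣) (m≤n⊔m ∣ a ∣ _)
  d≤ = m≤m⊔n ∣ d ∣ (∣ e ∣ ⊔ ∣ f ∣)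
  e≤ = ≤-trans (m≤m⊔n ∣ e ∣ ∣ f ∣) (m≤n⊔m ∣ d ∣ _)
  f≤ = ≤-trans (m≤n⊔m ∣ e ∣ ∣ f ∣) (m≤n⊔m ∣ d ∣ _)
  minor : ∀ x y z w → ∣ x ∣ ≤ U → ∣ y ∣ ≤ V → ∣ z ∣ ≤ U → ∣ w ∣ ≤ V →
    ∣ x *ᶻ y -ᶻ z *ᶻ w ∣ ≤ 2 * (U * V)
  minor x y z w x≤ y≤ z≤ w≤ = begin
    ∣ x *ᶻ y -ᶻ z *ᶻ w ∣           ≤⟨ ℤ.∣i-j∣≤∣i∣+∣j∣ (x *ᶻ y) (z *ᶻ w) ⟩
    ∣ x *ᶻ y ∣ + ∣ z *ᶻ w ∣        ≡⟨ cong₂ _+_ (ℤ.abs-* x y) (ℤ.abs-* z w) ⟩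
    ∣ x ∣ * ∣ y ∣ + ∣ z ∣ * ∣ w ∣  ≤⟨ +-mono-≤ (*-mono-≤ x≤ y≤) (*-mono-≤ z≤ w≤) ⟩
    U * V + U * V                  ≡⟨ cong₂ _+_ {x = U * V} refl (+-identityʳ (U * V)) ⟨
    2 * (U * V)                    ∎
    where open ≤-Reasoning

-- Coordinate differences and the solutions of a single relation

pattern 0F = zero
pattern 1F = suc zero
pattern 2F = suc (suc zero)
pattern 3F = suc (suc (suc zero))

-- An integer relation on four values with weights summing to zero is determined by its first three
-- weights: `N ∙ diff x ≡ 0ℤ` gives the fourth value the weight that makes the sum vanish.
diff : ∀ {M} → Vec (Fin M) 4 → ℤ³
diff (x ∷ y ∷ z ∷ w ∷ []) =
  + toℕ x -ᶻ + toℕ w , + toℕ y -ᶻ + toℕ w , + toℕ z -ᶻ + toℕ w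

coord-diff : ∀ {M} (x : Vec (Fin M) 4) i →
  coord (diff x) i ≡ + toℕ (lookup x (inject₁ i)) -ᶻ + toℕ (lookup x 3F)
coord-diff (x ∷ y ∷ z ∷ w ∷ []) 0F = refl
coord-diff (x ∷ y ∷ z ∷ w ∷ []) 1F = refl
coord-diff (x ∷ y ∷ z ∷ w ∷ []) 2F = refl

coord-• : ∀ t v i → coord (t • v) i ≡ t *ᶻ coord v i
coord-• t v 0F = refl
coord-• t v 1F = refl
coord-• t v 2F = refl

coord-⊝ : ∀ u v i → coord (u ⊝ v) i ≡ coord u i -ᶻ coord v i
coord-⊝ u v 0F = refl
coord-⊝ u v 1F = refl
coord-⊝ u v 2F = refl

∣+-+∣ : ∀ m n → ∣ + m -ᶻ + n ∣ ≤ m ⊔ n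
∣+-+∣ m n = subst (λ z → ∣ z ∣ ≤ m ⊔ n) (sym (ℤ.m-n≡m⊖n m n)) (ℤ.∣m⊝n∣≤m⊔n m n)

‖diff‖ : ∀ {M} (x : Vec (Fin M) 4) → ‖ diff x ‖ ≤ M
‖diff‖ {M} (x ∷ y ∷ z ∷ w ∷ []) = ⊔-lub (bound x) (⊔-lub (bound y) (bound z))
  where
  bound : ∀ (v : Fin M) → ∣ + toℕ v -ᶻ + toℕ w ∣ ≤ M
  bound v = ≤-trans (∣+-+∣ (toℕ v) (toℕ w)) (⊔-lub (<⇒≤ (Fin.toℕ<n v)) (<⇒≤ (Fin.toℕ<n w)))

diff-injective : ∀ {M} (x y : Vec (Fin M) 4) → lookup x 3F ≡ lookup y 3F → diff x ≡ diff y → x ≡ y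
diff-injective {M} (x ∷ y ∷ z ∷ w ∷ []) (x′ ∷ y′ ∷ z′ ∷ w ∷ []) refl eq =
  cong₂ _∷_ (back (cong proj₁ eq)) (cong₂ _∷_ (back (cong (proj₁ ∘ proj₂) eq))
    (cong (_∷ _) (back (cong (proj₂ ∘ proj₂) eq))))
  where
  back : ∀ {u v : Fin M} → + toℕ u -ᶻ + toℕ w ≡ + toℕ v -ᶻ + toℕ w → u ≡ v
  back {u} {v} h = Fin.toℕ-injective (ℤ.+-injective (trans (restore (+ toℕ u) (+ toℕ w))
    (trans (cong (_+ᶻ + toℕ w) h) (sym (restore (+ toℕ v) (+ toℕ w))))))
    where
    restore : ∀ a b → a ≡ (a -ᶻ b) +ᶻ b
    restore = ℤSolver.solve-∀

⊝≡𝟎⇒≡ : ∀ u v → u ⊝ v ≡ 𝟎 → u ≡ v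
⊝≡𝟎⇒≡ (a , b , c) (d , e , f) eq = triple-≡
  (ℤ.i-j≡0⇒i≡j a d (cong proj₁ eq)) (ℤ.i-j≡0⇒i≡j b e (cong (proj₁ ∘ proj₂) eq))
  (ℤ.i-j≡0⇒i≡j c f (cong (proj₂ ∘ proj₂) eq))

⨯-≡⇒⨯-⊝≡𝟎 : ∀ u v w → u ⨯ v ≡ u ⨯ w → u ⨯ (v ⊝ w) ≡ 𝟎
⨯-≡⇒⨯-⊝≡𝟎 u v w eq = trans (⨯-⊝ u v w) (trans (cong (_⊝ u ⨯ w) eq) (u⊝u≡𝟎 (u ⨯ w)))

-- Numbers the integers of absolute value at most R from 0 to 2R.
encode : ℕ → ℤ → ℕ
encode R (+ n)    = n
encode R -[1+ n ] = suc R + n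

encode-< : ∀ R t → ∣ t ∣ ≤ R → encode R t < suc R + R
encode-< R (+ n)    n≤R = s≤s (≤-trans n≤R (m≤m+n R R))
encode-< R -[1+ n ] n<R = +-monoʳ-< (suc R) n<R

encode-injective : ∀ R s t → ∣ s ∣ ≤ R → ∣ t ∣ ≤ R → encode R s ≡ encode R t → s ≡ t
encode-injective R (+ m)    (+ n)    _   _   eq = cong +_ eq
encode-injective R (+ m)    -[1+ n ] m≤R _   refl = contradiction m≤R (<⇒≱ (s≤s (m≤m+n R n)))
encode-injective R -[1+ m ] (+ n)    _   n≤R refl = contradiction n≤R (<⇒≱ (s≤s (m≤m+n R m)))
encode-injective R -[1+ m ] -[1+ n ] _   _   eq = cong -[1+_] (+-cancelˡ-≡ (suc R) m n eq)

/-≡⇒∣-∣< : ∀ m n l .{{_ : NonZero l}} → m / l ≡ n / l → ∣ + m -ᶻ + n ∣ < l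
/-≡⇒∣-∣< m n l eq = subst (_< l) (cong ∣_∣ (sym same))
  (≤-<-trans (∣+-+∣ (m % l) (n % l)) (⊔-pres-<m (m%n<n m l) (m%n<n n l)))
  where
  expand : ∀ k → + k ≡ + (k % l) +ᶻ + ((k / l) * l)
  expand k = trans (cong +_ (m≡m%n+[m/n]*n k l)) (ℤ.pos-+ (k % l) _)
  cancel : ∀ a b q → (a +ᶻ q) -ᶻ (b +ᶻ q) ≡ a -ᶻ b
  cancel = ℤSolver.solve-∀
  same : + m -ᶻ + n ≡ + (m % l) -ᶻ + (n % l)
  same = begin
    + m -ᶻ + n
      ≡⟨ cong₂ _-ᶻ_ (expand m) (expand n) ⟩
    (+ (m % l) +ᶻ + ((m / l) * l)) -ᶻ (+ (n % l) +ᶻ + ((n / l) * l))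
      ≡⟨ cong (λ q → (+ (m % l) +ᶻ + ((m / l) * l)) -ᶻ (+ (n % l) +ᶻ + (q * l))) eq ⟨
    (+ (m % l) +ᶻ + ((m / l) * l)) -ᶻ (+ (n % l) +ᶻ + ((m / l) * l))
      ≡⟨ cancel (+ (m % l)) (+ (n % l)) (+ ((m / l) * l)) ⟩
    + (m % l) -ᶻ + (n % l) ∎
    where open ≡-Reasoning

module _ (M : ℕ) where

  _⊥ᴺ?_ : ∀ (N : ℤ³) (x : Vec (Fin M) 4) → Dec (N ∙ diff x ≡ 0ℤ)
  N ⊥ᴺ? x = N ∙ diff x ℤ.≟ 0ℤ

  solutions : ℤ³ → ℕ
  solutions N = ∑ (vecs M 4) (λ x → ind (N ⊥ᴺ? x))

  -- Modulo translation the solutions form a plane lattice containing the primitive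
  -- vector e. The value of e ⨯ u = t • N determines the line parallel to e through u,
  -- and an interval of length ‖ e ‖ in a coordinate where e is largest contains
  -- at most one point of the line.
  solutions-≤-primitive : ∀ N e f → Primitive N → Primitive e → ‖ e ‖ ≤ M → ‖ f ‖ ≤ M →
    N ∙ e ≡ 0ℤ → N ∙ f ≡ 0ℤ → e ⨯ f ≢ 𝟎 → solutions N * ‖ N ‖ ≤ 12 * M ^ 3
  solutions-≤-primitive N e f N-prim@(p , _) e-prim@(q , _) e≤M f≤M N∙e N∙f e⨯f≢𝟎 = begin
    solutions N * ν
      ≤⟨ *-monoˡ-≤ ν (∑-ind-≤ (N ⊥ᴺ?_) (vecs-unique M 4) (λ {x} → key {x}) (λ {x y} → key-injective {x} {y})) ⟩
    M * ((suc R + R) * suc (M / ℓ)) * ν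
      ≤⟨ *-monoˡ-≤ ν (*-monoʳ-≤ M (*-mono-≤ (+-monoˡ-≤ (R + R) 1≤R) (+-monoˡ-≤ (M / ℓ) 1≤M/ℓ))) ⟩
    M * ((R + (R + R)) * (M / ℓ + M / ℓ)) * ν
      ≡⟨ regroup M R (M / ℓ) ν ⟩
    6 * M * (M / ℓ) * (R * ν)
      ≤⟨ *-monoʳ-≤ (6 * M * (M / ℓ)) (m/n*n≤m (2 * (ℓ * M)) ν) ⟩
    6 * M * (M / ℓ) * (2 * (ℓ * M))
      ≡⟨ regroup′ M (M / ℓ) ℓ ⟩
    12 * (M * M) * (M / ℓ * ℓ)
      ≤⟨ *-monoʳ-≤ (12 * (M * M)) (m/n*n≤m M ℓ) ⟩
    12 * (M * M) * M
      ≡⟨ cube M ⟩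
    12 * M ^ 3 ∎
    where
    open ≤-Reasoning
    ℓ = ‖ e ‖
    ν = ‖ N ‖
    scalar : ∀ u → N ∙ u ≡ 0ℤ → e ⨯ u ≡ (p ∙ (e ⨯ u)) • N
    scalar u N∙u = parallel⇒multiple N (e ⨯ u) N-prim (⊥⇒⨯⨯≡𝟎 N e u N∙e N∙u)
    nonzero : ∀ v → Primitive v → v ≢ 𝟎
    nonzero v (r , r∙v≡1) refl = contradiction (trans (sym r∙v≡1) (∙-𝟎 r)) λ ()
    instance
      ℓ≢0 : NonZero ℓ
      ℓ≢0 = >-nonZero (‖‖-positive (nonzero e e-prim))
      ν≢0 : NonZero ν
      ν≢0 = >-nonZero (‖‖-positive (nonzero N N-prim))
    R = 2 * (ℓ * M) / ν
    ∣t∣*ν≤ : ∀ u → ‖ u ‖ ≤ M → N ∙ u ≡ 0ℤ → ∣ p ∙ (e ⨯ u) ∣ * ν ≤ 2 * (ℓ * M)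
    ∣t∣*ν≤ u u≤M N∙u = begin
      ∣ p ∙ (e ⨯ u) ∣ * ν       ≡⟨ ‖•‖ (p ∙ (e ⨯ u)) N ⟨
      ‖ (p ∙ (e ⨯ u)) • N ‖     ≡⟨ cong ‖_‖ (scalar u N∙u) ⟨
      ‖ e ⨯ u ‖                 ≤⟨ ‖⨯‖ e u ⟩
      2 * (ℓ * ‖ u ‖)           ≤⟨ *-monoʳ-≤ 2 (*-monoʳ-≤ ℓ u≤M) ⟩
      2 * (ℓ * M)               ∎
    ∣t∣≤R : ∀ u → ‖ u ‖ ≤ M → N ∙ u ≡ 0ℤ → ∣ p ∙ (e ⨯ u) ∣ ≤ R
    ∣t∣≤R u u≤M N∙u = *≤⇒≤/ (∣ p ∙ (e ⨯ u) ∣) (∣t∣*ν≤ u u≤M N∙u)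
      where
      *≤⇒≤/ : ∀ s → s * ν ≤ 2 * (ℓ * M) → s ≤ R
      *≤⇒≤/ s h = subst (_≤ R) (m*n/n≡m s ν) (/-monoˡ-≤ ν h)
    -- The vector `f` is not parallel to `e`, so its parameter is a nonzero integer of absolute
    -- value at most `R`. Hence the `2R + 1` lines number at most `3R`; this is where the second
    -- short vector enters.
    1≤R : 1 ≤ R
    1≤R = ≤-trans (n≢0⇒n>0 λ t≡0 → e⨯f≢𝟎 (trans (scalar f N∙f)
            (trans (cong (_• N) (ℤ.∣i∣≡0⇒i≡0 {p ∙ (e ⨯ f)} t≡0)) (•-zeroˡ N)))) (∣t∣≤R f f≤M N∙f)
    1≤M/ℓ : 1 ≤ M / ℓ
    1≤M/ℓ = m≥n⇒m/n>0 e≤M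
    i : Fin 3
    i = proj₁ (∃coord≡‖‖ e)
    ∣eᵢ∣≡ℓ : ∣ coord e i ∣ ≡ ℓ
    ∣eᵢ∣≡ℓ = proj₂ (∃coord≡‖‖ e)
    t : Vec (Fin M) 4 → ℤ
    t x = p ∙ (e ⨯ diff x)
    key : ∀ {x} → N ∙ diff x ≡ 0ℤ → Fin (M * ((suc R + R) * suc (M / ℓ)))
    key {x} N∙x = combine (lookup x 3F) (combine
      (fromℕ< (encode-< R (t x) (∣t∣≤R (diff x) (‖diff‖ x) N∙x)))
      (fromℕ< (s≤s (/-monoˡ-≤ ℓ (<⇒≤ (Fin.toℕ<n (lookup x (inject₁ i))))))))
    key-injective : ∀ {x y} (N∙x : N ∙ diff x ≡ 0ℤ) (N∙y : N ∙ diff y ≡ 0ℤ) →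
      key {x} N∙x ≡ key {y} N∙y → x ≡ y
    key-injective {x} {y} N∙x N∙y eq =
      diff-injective x y eq₁ (⊝≡𝟎⇒≡ (diff x) (diff y) (trans d≡c•e
        (trans (cong (_• e) c≡0) (•-zeroˡ e))))
      where
      line-x = fromℕ< (encode-< R (t x) (∣t∣≤R (diff x) (‖diff‖ x) N∙x))
      line-y = fromℕ< (encode-< R (t y) (∣t∣≤R (diff y) (‖diff‖ y) N∙y))
      eqs = Fin.combine-injective (lookup x 3F) (combine line-x _) (lookup y 3F) (combine line-y _) eq
      eq₁ = proj₁ eqs
      eq₂ = proj₁ (Fin.combine-injective line-x _ line-y _ (proj₂ eqs))
      eq₃ = proj₂ (Fin.combine-injective line-x _ line-y _ (proj₂ eqs))
      d = diff x ⊝ diff y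
      c = q ∙ d
      tx≡ty : t x ≡ t y
      tx≡ty = encode-injective R (t x) (t y) (∣t∣≤R (diff x) (‖diff‖ x) N∙x)
        (∣t∣≤R (diff y) (‖diff‖ y) N∙y) (Fin.fromℕ<-injective _ _ _ _ eq₂)
      e⨯d≡𝟎 : e ⨯ d ≡ 𝟎
      e⨯d≡𝟎 = ⨯-≡⇒⨯-⊝≡𝟎 e (diff x) (diff y)
        (trans (scalar (diff x) N∙x) (trans (cong (_• N) tx≡ty) (sym (scalar (diff y) N∙y))))
      d≡c•e : d ≡ c • e
      d≡c•e = parallel⇒multiple e d e-prim e⨯d≡𝟎
      c≡0 : c ≡ 0ℤ
      c≡0 = ℤ.∣i∣≡0⇒i≡0 (n<1⇒n≡0 (*-cancelʳ-< ℓ (∣ c ∣) 1 (subst (∣ c ∣ * ℓ <_) (sym (*-identityˡ ℓ)) ∣c∣ℓ<ℓ)))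
        where
        coord-d : coord d i ≡ + toℕ (lookup x (inject₁ i)) -ᶻ + toℕ (lookup y (inject₁ i))
        coord-d = trans (coord-⊝ (diff x) (diff y) i) (trans
          (cong₂ _-ᶻ_ (coord-diff x i) (trans (coord-diff y i)
            (cong (λ z → + toℕ (lookup y (inject₁ i)) -ᶻ + toℕ z) (sym eq₁))))
          (cancel (+ toℕ (lookup x (inject₁ i))) (+ toℕ (lookup y (inject₁ i))) (+ toℕ (lookup x 3F))))
          where
          cancel : ∀ a b w → (a -ᶻ w) -ᶻ (b -ᶻ w) ≡ a -ᶻ b
          cancel = ℤSolver.solve-∀
        ∣c∣ℓ<ℓ : ∣ c ∣ * ℓ < ℓ
        ∣c∣ℓ<ℓ = subst (_< ℓ)
          (trans (cong ∣_∣ (trans (sym coord-d) (trans (cong (λ v → coord v i) d≡c•e) (coord-• c e i))))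
            (trans (ℤ.abs-* c (coord e i)) (cong (∣ c ∣ *_) ∣eᵢ∣≡ℓ)))
          (/-≡⇒∣-∣< _ _ ℓ (Fin.fromℕ<-injective _ _ _ _ eq₃))
    regroup : ∀ M R Q ν → M * ((R + (R + R)) * (Q + Q)) * ν ≡ 6 * M * Q * (R * ν)
    regroup = solve-∀
    regroup′ : ∀ M Q ℓ → 6 * M * Q * (2 * (ℓ * M)) ≡ 12 * (M * M) * (Q * ℓ)
    regroup′ = solve-∀
    cube : ∀ M → 12 * (M * M) * M ≡ 12 * (M * (M * (M * 1)))
    cube = solve-∀

-- Enumeration of the relations by dyadic scale

ints : ℕ → List ℤ
ints L = map +_ (upTo (suc L)) ++ map -[1+_] (upTo L)

∈-ints : ∀ {L} a → ∣ a ∣ ≤ L → a ∈ ints L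
∈-ints     (+ n)    n≤L = ∈-++⁺ˡ (∈-map⁺ +_ (∈-upTo⁺ (s≤s n≤L)))
∈-ints {L} -[1+ n ] n<L = ∈-++⁺ʳ (map +_ (upTo (suc L))) (∈-map⁺ -[1+_] (∈-upTo⁺ n<L))

length-ints : ∀ {L} → 1 ≤ L → length (ints L) ≤ 3 * L
length-ints {L} 1≤L = begin
  length (ints L)                                  ≡⟨ length-++ (map +_ (upTo (suc L))) ⟩
  length (map +_ (upTo (suc L))) + length (map -[1+_] (upTo L))
    ≡⟨ cong₂ _+_ (trans (length-map +_ (upTo (suc L))) (length-upTo (suc L)))
         (trans (length-map -[1+_] (upTo L)) (length-upTo L)) ⟩
  suc L + L                                        ≤⟨ +-monoˡ-≤ (L + L) 1≤L ⟩
  L + (L + L)                                      ≡⟨ cong (λ z → L + (L + z)) (+-identityʳ L) ⟨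
  3 * L                                            ∎
  where open ≤-Reasoning

box : ℕ → List ℤ³
box L = cartesianProduct (ints L) (cartesianProduct (ints L) (ints L))

∈-box : ∀ {L} v → ‖ v ‖ ≤ L → v ∈ box L
∈-box (a , b , c) v≤L =
  ∈-cartesianProduct⁺ (∈-ints a (m⊔n≤o⇒m≤o (∣ a ∣) (∣ b ∣ ⊔ ∣ c ∣) v≤L))
    (∈-cartesianProduct⁺ (∈-ints b (m⊔n≤o⇒m≤o (∣ b ∣) (∣ c ∣) bc≤L)) (∈-ints c (m⊔n≤o⇒n≤o (∣ b ∣) (∣ c ∣) bc≤L)))
  where
  bc≤L = m⊔n≤o⇒n≤o (∣ a ∣) (∣ b ∣ ⊔ ∣ c ∣) v≤L

length-box : ∀ {L} → 1 ≤ L → length (box L) ≤ 27 * L ^ 3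
length-box {L} 1≤L = begin
  length (box L)
    ≡⟨ length-cartesianProductWith _,_ (ints L) (cartesianProduct (ints L) (ints L)) ⟩
  length (ints L) * length (cartesianProduct (ints L) (ints L))
    ≡⟨ cong (length (ints L) *_) (length-cartesianProductWith _,_ (ints L) (ints L)) ⟩
  length (ints L) * (length (ints L) * length (ints L))
    ≤⟨ *-mono-≤ (length-ints 1≤L) (*-mono-≤ (length-ints 1≤L) (length-ints 1≤L)) ⟩
  3 * L * (3 * L * (3 * L))
    ≡⟨ cube L ⟩
  27 * L ^ 3 ∎
  where
  open ≤-Reasoning
  cube : ∀ L → 3 * L * (3 * L * (3 * L)) ≡ 27 * (L * (L * (L * 1)))
  cube = solve-∀

-- Base 2 rounds the norm of a relation up to its scale; base 8 rounds the volume of the cube, so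
-- that its side becomes a power of two.
∃power : ∀ b → 2 ≤ b → ∀ n → 1 ≤ n → ∃[ j ] (n ≤ b ^ j × b ^ j ≤ b * n)
∃power b 2≤b (suc zero)    _ = 0 , ≤-refl , ≤-trans (<⇒≤ 2≤b) (≤-reflexive (sym (*-identityʳ b)))
∃power b 2≤b (suc (suc n)) _ with ∃power b 2≤b (suc n) (s≤s z≤n)
... | j , n≤ , ≤bn with suc (suc n) ≤? b ^ j
...   | yes sn≤ = j , sn≤ , ≤-trans ≤bn (*-monoʳ-≤ b (n≤1+n (suc n)))
...   | no  sn≰ = suc j ,
  (begin
    suc (suc n)        ≤⟨ +-mono-≤ (m^n>0 b {{>-nonZero (<⇒≤ 2≤b)}} j) n≤ ⟩
    b ^ j + b ^ j      ≡⟨ cong (λ z → b ^ j + z) (+-identityʳ (b ^ j)) ⟨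
    2 * b ^ j          ≤⟨ *-monoˡ-≤ (b ^ j) 2≤b ⟩
    b * b ^ j          ∎) ,
  *-monoʳ-≤ b (<⇒≤ (≰⇒> sn≰))
  where open ≤-Reasoning

-- Replacing `e` by its primitive part does not lengthen it and keeps it orthogonal to `N` and not
-- parallel to `f`.
solutions-≤ : ∀ M N e f → Primitive N → ‖ e ‖ ≤ M → ‖ f ‖ ≤ M →
  N ∙ e ≡ 0ℤ → N ∙ f ≡ 0ℤ → e ⨯ f ≢ 𝟎 → solutions M N * ‖ N ‖ ≤ 12 * M ^ 3
solutions-≤ M N e f N-prim e≤M f≤M N∙e N∙f e⨯f≢𝟎
  with g , e′ , refl , e′-prim ← primitivePart e (λ { refl → e⨯f≢𝟎 refl }) =
  solutions-≤-primitive M N e′ f N-prim e′-prim (≤-trans e′≤e e≤M) f≤M N∙e′ N∙f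
    (λ eq → e⨯f≢𝟎 (trans (•-⨯ g e′ f) (trans (cong (g •_) eq) (•-zeroʳ g))))
  where
  g≢0 : g ≢ 0ℤ
  g≢0 refl = e⨯f≢𝟎 refl
  e′≤e : ‖ e′ ‖ ≤ ‖ g • e′ ‖
  e′≤e = subst (‖ e′ ‖ ≤_) (sym (‖•‖ g e′))
    (m≤n*m ‖ e′ ‖ ∣ g ∣ {{>-nonZero (n≢0⇒n>0 (g≢0 ∘ ℤ.∣i∣≡0⇒i≡0))}})
  N∙e′ : N ∙ e′ ≡ 0ℤ
  N∙e′ = *≡0⇒≡0 g≢0 (trans (cong (g *ᶻ_) (∙-comm N e′))
    (trans (sym (•-∙ g e′ N)) (trans (∙-comm (g • e′) N) N∙e)))

-- Relations are selected by size and by the count bound itself, which is decidable and is what the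
-- union bound consumes, instead of by the existence of short orthogonal vectors. The constant is
-- `24 = 2 * 12` because `2 ^ j` may be twice the norm.
normals : ℕ → ℕ → List ℤ³
normals M j = filter (λ N → solutions M N * 2 ^ j ≤? 24 * M ^ 3) (box (2 ^ j))

-- The relation is the primitive part of `e ⨯ f`, of norm at most `2 * (M * M)`; rounding up to a
-- power of two at most doubles this, whence the `4`.
∃normal : ∀ M e f → ‖ e ‖ ≤ M → ‖ f ‖ ≤ M → e ⨯ f ≢ 𝟎 →
  ∃[ j ] ∃[ N ] (2 ^ j ≤ 4 * (M * M) × N ∈ normals M j × (∀ u → (e ⨯ f) ∙ u ≡ 0ℤ → N ∙ u ≡ 0ℤ))
∃normal M e f e≤M f≤M e⨯f≢𝟎
  with t , N , e⨯f≡ , N-prim ← primitivePart (e ⨯ f) e⨯f≢𝟎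
  with j , N≤2ʲ , 2ʲ≤2N ← ∃power 2 ≤-refl ‖ N ‖
    (‖‖-positive {N} λ { refl → e⨯f≢𝟎 (trans e⨯f≡ (•-zeroʳ t)) }) =
  j , N ,
  (begin
    2 ^ j                       ≤⟨ 2ʲ≤2N ⟩
    2 * ‖ N ‖                   ≤⟨ *-monoʳ-≤ 2 (m≤n*m ‖ N ‖ ∣ t ∣ {{>-nonZero (n≢0⇒n>0 (t≢0 ∘ ℤ.∣i∣≡0⇒i≡0))}}) ⟩
    2 * (∣ t ∣ * ‖ N ‖)         ≡⟨ cong (2 *_) (trans (cong ‖_‖ e⨯f≡) (‖•‖ t N)) ⟨
    2 * ‖ e ⨯ f ‖               ≤⟨ *-monoʳ-≤ 2 (≤-trans (‖⨯‖ e f) (*-monoʳ-≤ 2 (*-mono-≤ e≤M f≤M))) ⟩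
    2 * (2 * (M * M))           ≡⟨ *-assoc 2 2 (M * M) ⟨
    4 * (M * M)                 ∎) ,
  ∈-filter⁺ (λ N → solutions M N * 2 ^ j ≤? 24 * M ^ 3) (∈-box N N≤2ʲ) (begin
    solutions M N * 2 ^ j          ≤⟨ *-monoʳ-≤ (solutions M N) 2ʲ≤2N ⟩
    solutions M N * (2 * ‖ N ‖)    ≡⟨ swap (solutions M N) ‖ N ‖ ⟩
    2 * (solutions M N * ‖ N ‖)    ≤⟨ *-monoʳ-≤ 2 (solutions-≤ M N e f N-prim e≤M f≤M
                                        (transfer e (⨯-∙ˡ e f)) (transfer f (⨯-∙ʳ e f)) e⨯f≢𝟎) ⟩
    2 * (12 * M ^ 3)               ≡⟨ *-assoc 2 12 (M ^ 3) ⟨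
    24 * M ^ 3                     ∎) ,
  transfer
  where
  open ≤-Reasoning
  t≢0 : t ≢ 0ℤ
  t≢0 refl = e⨯f≢𝟎 e⨯f≡
  transfer : ∀ u → (e ⨯ f) ∙ u ≡ 0ℤ → N ∙ u ≡ 0ℤ
  transfer u h = *≡0⇒≡0 t≢0 (trans (sym (•-∙ t N u)) (trans (cong (_∙ u) (sym e⨯f≡)) h))
  swap : ∀ s ν → s * (2 * ν) ≡ 2 * (s * ν)
  swap = solve-∀

-- Applied to the three columns of coordinate differences of four points: if the columns lie
-- in a plane, then so do the points.
NoCommonPlane : ℕ → ℤ³ → ℤ³ → ℤ³ → Set
NoCommonPlane M u v w = ∀ e f → ‖ e ‖ ≤ M → ‖ f ‖ ≤ M → e ⨯ f ≢ 𝟎 →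
  (e ⨯ f) ∙ u ≡ 0ℤ → (e ⨯ f) ∙ v ≡ 0ℤ → (e ⨯ f) ∙ w ≡ 0ℤ → ⊥

-- Union bound over quadruples, scales and relations

∑-cartesianProduct-* : (xs : List A) (ys : List B) (f : A → ℕ) (g : B → ℕ) →
  ∑ (cartesianProduct xs ys) (λ (x , y) → f x * g y) ≡ ∑ xs f * ∑ ys g
∑-cartesianProduct-* xs ys f g = begin
  ∑ (cartesianProduct xs ys) (λ (x , y) → f x * g y)  ≡⟨ ∑-cartesianProductWith _,_ xs ys _ ⟩
  ∑ xs (λ x → ∑ ys (λ y → f x * g y))                 ≡⟨ ∑-cong xs (λ x → ∑-*ˡ ys g (f x)) ⟩
  ∑ xs (λ x → f x * ∑ ys g)                           ≡⟨ ∑-*ʳ xs f (∑ ys g) ⟩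
  ∑ xs f * ∑ ys g                                     ∎
  where open ≡-Reasoning

module _ (M : ℕ) {{_ : NonZero M}} {n : ℕ} where

  hit : ℤ³ → Vec (Fin n) 4 → Vec (Fin M) n → ℕ
  hit N q X = ind (_⊥ᴺ?_ M N (pick X q))

  -- The sample space is arranged by coordinate, not by vertex: independence of the three
  -- coordinates then becomes the factorisation of a sum over a product.
  Ω : List (Vec (Fin M) n × Vec (Fin M) n × Vec (Fin M) n)
  Ω = cartesianProduct (vecs M n) (cartesianProduct (vecs M n) (vecs M n))

  length-Ω : length Ω ≡ M ^ n * (M ^ n * M ^ n)
  length-Ω = trans (length-cartesianProductWith _,_ (vecs M n) (cartesianProduct (vecs M n) (vecs M n)))
    (cong₂ _*_ (length-vecs M n) (trans (length-cartesianProductWith _,_ (vecs M n) (vecs M n))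
      (cong₂ _*_ (length-vecs M n) (length-vecs M n))))

  hit³ : ℤ³ → Vec (Fin n) 4 → Vec (Fin M) n × Vec (Fin M) n × Vec (Fin M) n → ℕ
  hit³ N q (X , Y , Z) = hit N q X * (hit N q Y * hit N q Z)

  -- In one coordinate, a relation of scale `2 ^ j` holds with probability at most
  -- `24 / (2 ^ j * M)`.
  ∑-hit : ∀ {q} → UniqueVec q → ∀ {j N} → N ∈ normals M j →
    ∑ (vecs M n) (hit N q) * (2 ^ j * M) ≤ 24 * M ^ n
  ∑-hit {q} q-unique {j} {N} N∈ = *-cancelˡ-≤ (M ^ 3) {{m^n≢0 M 3}} (begin
    M ^ 3 * (σ * (2 ^ j * M))              ≡⟨ regroup M σ (2 ^ j) ⟩
    M ^ 4 * σ * 2 ^ j                      ≡⟨ cong (_* 2 ^ j) (∑-pick M q q-unique (λ x → ind (_⊥ᴺ?_ M N x))) ⟩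
    M ^ n * solutions M N * 2 ^ j          ≡⟨ *-assoc (M ^ n) (solutions M N) (2 ^ j) ⟩
    M ^ n * (solutions M N * 2 ^ j)        ≤⟨ *-monoʳ-≤ (M ^ n) (proj₂ (∈-filter⁻
                                                (λ N → solutions M N * 2 ^ j ≤? 24 * M ^ 3) {xs = box (2 ^ j)} N∈)) ⟩
    M ^ n * (24 * M ^ 3)                   ≡⟨ rotate (M ^ n) 24 (M ^ 3) ⟩
    M ^ 3 * (24 * M ^ n)                   ∎)
    where
    open ≤-Reasoning
    σ = ∑ (vecs M n) (hit N q)
    regroup : ∀ M σ L → M * (M * (M * 1)) * (σ * (L * M)) ≡ M * (M * (M * (M * 1))) * σ * L
    regroup = solve-∀
    rotate : ∀ a b c → a * (b * c) ≡ c * (b * a)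
    rotate = solve-∀

  -- There are at most `27 * (2 ^ j) ^ 3` relations at the scale, each holding with probability at
  -- most `(24 / (2 ^ j * M)) ^ 3`. The powers of `2 ^ j` cancel, so the bound is the same for all
  -- `j`.
  ∑-hit³ : ∀ {q} → UniqueVec q → ∀ j →
    ∑ (normals M j) (λ N → ∑ Ω (hit³ N q)) * M ^ 3 ≤ 27 * (24 * M ^ n) ^ 3
  ∑-hit³ {q} q-unique j = *-cancelʳ-≤ _ _ (L ^ 3) {{m^n≢0 L 3 {{m^n≢0 2 j}}}} (begin
    ∑ (normals M j) (λ N → ∑ Ω (hit³ N q)) * M ^ 3 * L ^ 3
      ≡⟨ *-assoc (∑ (normals M j) (λ N → ∑ Ω (hit³ N q))) (M ^ 3) (L ^ 3) ⟩
    ∑ (normals M j) (λ N → ∑ Ω (hit³ N q)) * (M ^ 3 * L ^ 3)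
      ≤⟨ ∑-≤-length (normals M j) _ (M ^ 3 * L ^ 3) ((24 * M ^ n) ^ 3) single ⟩
    length (normals M j) * (24 * M ^ n) ^ 3
      ≤⟨ *-monoˡ-≤ ((24 * M ^ n) ^ 3) (≤-trans
           (length-filter (λ N → solutions M N * 2 ^ j ≤? 24 * M ^ 3) (box L)) (length-box (m^n>0 2 j))) ⟩
    27 * L ^ 3 * (24 * M ^ n) ^ 3
      ≡⟨ rotate 27 (L ^ 3) ((24 * M ^ n) ^ 3) ⟩
    27 * (24 * M ^ n) ^ 3 * L ^ 3 ∎)
    where
    open ≤-Reasoning
    L = 2 ^ j
    rotate : ∀ a b c → a * b * c ≡ a * c * b
    rotate = solve-∀
    cube : ∀ s L M → s * (s * s) * (M * (M * (M * 1)) * (L * (L * (L * 1)))) ≡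
      s * (L * M) * (s * (L * M) * (s * (L * M) * 1))
    cube = solve-∀
    single : ∀ {N} → N ∈ normals M j → ∑ Ω (hit³ N q) * (M ^ 3 * L ^ 3) ≤ (24 * M ^ n) ^ 3
    single {N} N∈ = begin
      ∑ Ω (hit³ N q) * (M ^ 3 * L ^ 3)
        ≡⟨ cong (_* (M ^ 3 * L ^ 3)) (trans
             (∑-cartesianProduct-* (vecs M n) _ (hit N q) (λ (Y , Z) → hit N q Y * hit N q Z))
             (cong (σ *_) (∑-cartesianProduct-* (vecs M n) (vecs M n) (hit N q) (hit N q)))) ⟩
      σ * (σ * σ) * (M ^ 3 * L ^ 3)
        ≡⟨ cube σ L M ⟩
      (σ * (L * M)) ^ 3
        ≤⟨ ^-monoˡ-≤ 3 (∑-hit q-unique {j} N∈) ⟩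
      (24 * M ^ n) ^ 3 ∎
      where
      σ = ∑ (vecs M n) (hit N q)

  Generic : List (Vec (Fin n) 4) → Vec (Fin M) n → Vec (Fin M) n → Vec (Fin M) n → Set
  Generic Q X Y Z = ∀ {q} → q ∈ Q → NoCommonPlane M (diff (pick X q)) (diff (pick Y q)) (diff (pick Z q))

  module _ (Q : List (Vec (Fin n) 4)) (Q-unique : ∀ {q} → q ∈ Q → UniqueVec q)
           (J : ℕ) (4M²<2ᴶ : 4 * (M * M) < 2 ^ J)
           (few : length Q * J * (27 * 24 ^ 3) < M ^ 3) where

    hits : Vec (Fin M) n × Vec (Fin M) n × Vec (Fin M) n → ℕ
    hits ω = ∑ Q (λ q → ∑ (upTo J) (λ j → ∑ (normals M j) (λ N → hit³ N q ω)))

    -- The expected number of hits is at most `length Q * J * (27 * 24 ^ 3) / M ^ 3`, which `few`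
    -- makes less than 1.
    ∑-hits : ∑ Ω hits < length Ω
    ∑-hits = *-cancelʳ-< (M ^ 3) _ _ (begin-strict
      ∑ Ω hits * M ^ 3
        ≡⟨ cong (_* M ^ 3) exchange ⟩
      ∑ Q (λ q → ∑ (upTo J) (level q)) * M ^ 3
        ≤⟨ ∑-≤-length Q (λ q → ∑ (upTo J) (level q)) (M ^ 3) (J * bound) (λ {q} q∈ →
             subst (λ k → ∑ (upTo J) (level q) * M ^ 3 ≤ k * bound) (length-upTo J)
               (∑-≤-length (upTo J) (level q) (M ^ 3) bound (λ {j} _ → ∑-hit³ (Q-unique q∈) j))) ⟩
      length Q * (J * bound)
        ≡⟨ regroup (length Q) J 27 24 (M ^ n) ⟩
      length Q * J * (27 * 24 ^ 3) * (M ^ n * (M ^ n * M ^ n))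
        <⟨ *-monoˡ-< (M ^ n * (M ^ n * M ^ n)) {{m*n≢0 (M ^ n) (M ^ n * M ^ n) {{m^n≢0 M n}}
             {{m*n≢0 (M ^ n) (M ^ n) {{m^n≢0 M n}} {{m^n≢0 M n}}}}}} few ⟩
      M ^ 3 * (M ^ n * (M ^ n * M ^ n))
        ≡⟨ *-comm (M ^ 3) _ ⟩
      M ^ n * (M ^ n * M ^ n) * M ^ 3
        ≡⟨ cong (_* M ^ 3) length-Ω ⟨
      length Ω * M ^ 3 ∎)
      where
      open ≤-Reasoning
      level : Vec (Fin n) 4 → ℕ → ℕ
      level q j = ∑ (normals M j) (λ N → ∑ Ω (hit³ N q))
      bound = 27 * (24 * M ^ n) ^ 3
      exchange : ∑ Ω hits ≡ ∑ Q (λ q → ∑ (upTo J) (level q))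
      exchange = trans (∑-swap Ω Q _) (∑-cong Q λ q → trans (∑-swap Ω (upTo J) _)
        (∑-cong (upTo J) λ j → ∑-swap Ω (normals M j) _))
      regroup : ∀ a b c d x →
        a * (b * (c * (d * x * (d * x * (d * x * 1))))) ≡ a * b * (c * (d * (d * (d * 1)))) * (x * (x * x))
      regroup = solve-∀

    avoid : ∀ {q} → q ∈ Q → ∀ ω → hits ω ≡ 0 → ∀ {j N} → 2 ^ j ≤ 4 * (M * M) → N ∈ normals M j →
      hit³ N q ω ≢ 1
    avoid {q} q∈ ω none {j} {N} 2ʲ≤ N∈ product≡1 = contradiction (trans (sym product≡1) product≡0) λ ()
      where
      j<J : j < J
      j<J = ≰⇒> λ J≤j → <⇒≱ 4M²<2ᴶ (≤-trans (^-monoʳ-≤ 2 J≤j) 2ʲ≤)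
      product≡0 : hit³ N q ω ≡ 0
      product≡0 = ∑≡0⇒≡0 (normals M j) (λ N → hit³ N q ω)
        (∑≡0⇒≡0 (upTo J) (λ j → ∑ (normals M j) (λ N → hit³ N q ω))
          (∑≡0⇒≡0 Q (λ q → ∑ (upTo J) (λ j → ∑ (normals M j) (λ N → hit³ N q ω))) none q∈)
          (∈-upTo⁺ j<J)) N∈

    ∃generic : ∃[ X ] ∃[ Y ] ∃[ Z ] Generic Q X Y Z
    ∃generic = witness (∑<length⇒∃≡0 Ω hits ∑-hits)
      where
      witness : (∃[ ω ] hits ω ≡ 0) → ∃[ X ] ∃[ Y ] ∃[ Z ] Generic Q X Y Z
      witness (ω@(X , Y , Z) , none) = X , Y , Z , λ {q} q∈ e f e≤M f≤M e⨯f≢𝟎 x y z →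
        let j , N , 2ʲ≤ , N∈ , transfer = ∃normal M e f e≤M f≤M e⨯f≢𝟎 in
        avoid q∈ ω none {j} {N} 2ʲ≤ N∈
          (cong₂ _*_ (ind-yes (_⊥ᴺ?_ M N (pick X q)) (transfer (diff (pick X q)) x))
            (cong₂ _*_ (ind-yes (_⊥ᴺ?_ M N (pick Y q)) (transfer (diff (pick Y q)) y))
                       (ind-yes (_⊥ᴺ?_ M N (pick Z q)) (transfer (diff (pick Z q)) z))))

-- Determinants, collinearity and crossing segments

𝟏 : ℤ³
𝟏 = 1ℤ , 1ℤ , 1ℤ

_≟³_ : DecidableEquality ℤ³
_≟³_ = Product.≡-dec ℤ._≟_ (Product.≡-dec ℤ._≟_ ℤ._≟_)

⨯≡𝟎-sym : ∀ u v → u ⨯ v ≡ 𝟎 → v ⨯ u ≡ 𝟎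
⨯≡𝟎-sym (a , b , c) (d , e , f) eq = triple-≡
  (trans (identity b c e f) (cong (-ᶻ_ ∘ proj₁) eq))
  (trans (identity c a f d) (cong (-ᶻ_ ∘ proj₁ ∘ proj₂) eq))
  (trans (identity a b d e) (cong (-ᶻ_ ∘ proj₂ ∘ proj₂) eq))
  where
  identity : ∀ b c e f → e *ᶻ c -ᶻ f *ᶻ b ≡ -ᶻ (b *ᶻ f -ᶻ c *ᶻ e)
  identity = ℤSolver.solve-∀

⨯∙-rotate : ∀ u v w → (u ⨯ v) ∙ w ≡ (v ⨯ w) ∙ u
⨯∙-rotate (a , b , c) (d , e , f) (g , h , i) = identity a b c d e f g h i
  where
  identity : ∀ a b c d e f g h i →
    (b *ᶻ f -ᶻ c *ᶻ e) *ᶻ g +ᶻ (c *ᶻ d -ᶻ a *ᶻ f) *ᶻ h +ᶻ (a *ᶻ e -ᶻ b *ᶻ d) *ᶻ i ≡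
    (e *ᶻ i -ᶻ f *ᶻ h) *ᶻ a +ᶻ (f *ᶻ g -ᶻ d *ᶻ i) *ᶻ b +ᶻ (d *ᶻ h -ᶻ e *ᶻ g) *ᶻ c
  identity = ℤSolver.solve-∀

⨯∙-swap : ∀ u v w → (u ⨯ v) ∙ w ≡ -ᶻ ((u ⨯ w) ∙ v)
⨯∙-swap (a , b , c) (d , e , f) (g , h , i) = identity a b c d e f g h i
  where
  identity : ∀ a b c d e f g h i →
    (b *ᶻ f -ᶻ c *ᶻ e) *ᶻ g +ᶻ (c *ᶻ d -ᶻ a *ᶻ f) *ᶻ h +ᶻ (a *ᶻ e -ᶻ b *ᶻ d) *ᶻ i ≡
    -ᶻ ((b *ᶻ i -ᶻ c *ᶻ h) *ᶻ d +ᶻ (c *ᶻ g -ᶻ a *ᶻ i) *ᶻ e +ᶻ (a *ᶻ h -ᶻ b *ᶻ g) *ᶻ f)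
  identity = ℤSolver.solve-∀

⨯-self-∙ : ∀ u v → (u ⨯ u) ∙ v ≡ 0ℤ
⨯-self-∙ u v = trans (⨯∙-swap u u v) (cong -ᶻ_ (⨯-∙ˡ u v))

⨯∙-swap-≡0 : ∀ u v w → (u ⨯ w) ∙ v ≡ 0ℤ → (u ⨯ v) ∙ w ≡ 0ℤ
⨯∙-swap-≡0 u v w eq = trans (⨯∙-swap u v w) (cong -ᶻ_ eq)

⨯-rotate : ∀ a b c → (b ⊝ a) ⨯ (c ⊝ a) ≡ (a ⊝ c) ⨯ (b ⊝ c)
⨯-rotate (a , b , c) (d , e , f) (g , h , i) =
  triple-≡ (identity b c e f h i) (identity c a f d i g) (identity a b d e g h)
  where
  identity : ∀ b c e f h i →
    (e -ᶻ b) *ᶻ (i -ᶻ c) -ᶻ (f -ᶻ c) *ᶻ (h -ᶻ b) ≡ (b -ᶻ h) *ᶻ (f -ᶻ i) -ᶻ (c -ᶻ i) *ᶻ (e -ᶻ h)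
  identity = ℤSolver.solve-∀

-- Cramer's rule: the determinant times the first entry of `n` is a combination of the three
-- products of `n` with the columns.
⊥⇒⨯∙≡0 : ∀ n u v w → proj₁ n ≢ 0ℤ → n ∙ u ≡ 0ℤ → n ∙ v ≡ 0ℤ → n ∙ w ≡ 0ℤ → (u ⨯ v) ∙ w ≡ 0ℤ
⊥⇒⨯∙≡0 (l , m , n) (a , b , c) (d , e , f) (g , h , i) l≢0 nu nv nw =
  *≡0⇒≡0 l≢0 (trans (identity a b c d e f g h i l m n) vanish)
  where
  identity : ∀ a1 a2 a3 b1 b2 b3 c1 c2 c3 n1 n2 n3 →
    n1 *ᶻ ((a2 *ᶻ b3 -ᶻ a3 *ᶻ b2) *ᶻ c1 +ᶻ (a3 *ᶻ b1 -ᶻ a1 *ᶻ b3) *ᶻ c2 +ᶻ (a1 *ᶻ b2 -ᶻ a2 *ᶻ b1) *ᶻ c3) ≡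
    (n1 *ᶻ a1 +ᶻ n2 *ᶻ a2 +ᶻ n3 *ᶻ a3) *ᶻ (b2 *ᶻ c3 -ᶻ b3 *ᶻ c2) +ᶻ
    (n1 *ᶻ b1 +ᶻ n2 *ᶻ b2 +ᶻ n3 *ᶻ b3) *ᶻ (c2 *ᶻ a3 -ᶻ c3 *ᶻ a2) +ᶻ
    (n1 *ᶻ c1 +ᶻ n2 *ᶻ c2 +ᶻ n3 *ᶻ c3) *ᶻ (a2 *ᶻ b3 -ᶻ a3 *ᶻ b2)
  identity = ℤSolver.solve-∀
  vanish : (l *ᶻ a +ᶻ m *ᶻ b +ᶻ n *ᶻ c) *ᶻ (e *ᶻ i -ᶻ f *ᶻ h) +ᶻ
    (l *ᶻ d +ᶻ m *ᶻ e +ᶻ n *ᶻ f) *ᶻ (h *ᶻ c -ᶻ i *ᶻ b) +ᶻ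
    (l *ᶻ g +ᶻ m *ᶻ h +ᶻ n *ᶻ i) *ᶻ (b *ᶻ f -ᶻ c *ᶻ e) ≡ 0ℤ
  vanish rewrite nu | nv | nw = refl

module _ {M : ℕ} {u v w : ℤ³} (no-plane : NoCommonPlane M u v w)
         (u≤M : ‖ u ‖ ≤ M) (v≤M : ‖ v ‖ ≤ M) (w≤M : ‖ w ‖ ≤ M) where

  -- If `p ⨯ u` were nonzero, it would be a relation spanned by the short vectors `p` and `u` and
  -- orthogonal to all three columns; likewise for `v` and `w`. Here `p` may be a column or `𝟏`.
  coplanar⇒parallel : ∀ p → ‖ p ‖ ≤ M →
    (p ⨯ u) ∙ v ≡ 0ℤ → (p ⨯ v) ∙ w ≡ 0ℤ → (p ⨯ w) ∙ u ≡ 0ℤ →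
    p ⨯ u ≡ 𝟎 × p ⨯ v ≡ 𝟎 × p ⨯ w ≡ 𝟎
  coplanar⇒parallel p p≤M puv pvw pwu =
    decidable-stable (_ ≟³ _) (λ ≢𝟎 → no-plane p u p≤M u≤M ≢𝟎 (⨯-∙ʳ p u) puv (⨯∙-swap-≡0 p u w pwu)) ,
    decidable-stable (_ ≟³ _) (λ ≢𝟎 → no-plane p v p≤M v≤M ≢𝟎 (⨯∙-swap-≡0 p v u puv) (⨯-∙ʳ p v) pvw) ,
    decidable-stable (_ ≟³ _) (λ ≢𝟎 → no-plane p w p≤M w≤M ≢𝟎 pwu (⨯∙-swap-≡0 p w v pvw) (⨯-∙ʳ p w))

  singular⇒parallel : (u ⨯ v) ∙ w ≡ 0ℤ → u ⨯ v ≡ 𝟎 × v ⨯ w ≡ 𝟎 × w ⨯ u ≡ 𝟎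
  singular⇒parallel uvw =
    proj₁ (proj₂ from-u) , proj₂ (proj₂ from-v) , ⨯≡𝟎-sym u w (proj₂ (proj₂ from-u))
    where
    from-u = coplanar⇒parallel u u≤M (⨯-self-∙ u v) uvw (⨯-∙ˡ u w)
    from-v = coplanar⇒parallel v v≤M (⨯-∙ˡ v u) (⨯-self-∙ v w) (trans (sym (⨯∙-rotate u v w)) uvw)

Collinear : ℤ³ → ℤ³ → ℤ³ → Set
Collinear a b c = (a ⊝ c) ⨯ (b ⊝ c) ≡ 𝟎

combination⇒⨯≡𝟎 : ∀ s t u v → s ≢ 0ℤ ⊎ t ≢ 0ℤ →
  (∀ i → s *ᶻ coord u i +ᶻ t *ᶻ coord v i ≡ 0ℤ) → u ⨯ v ≡ 𝟎
combination⇒⨯≡𝟎 s t (a , b , c) (d , e , f) nonzero h =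
  triple-≡ (minor b e c f (h 1F) (h 2F)) (minor c f a d (h 2F) (h 0F)) (minor a d b e (h 0F) (h 1F))
  where
  identityₛ : ∀ s t x y x′ y′ → s *ᶻ (x *ᶻ y′ -ᶻ x′ *ᶻ y) ≡
    (s *ᶻ x +ᶻ t *ᶻ y) *ᶻ y′ -ᶻ (s *ᶻ x′ +ᶻ t *ᶻ y′) *ᶻ y
  identityₛ = ℤSolver.solve-∀
  identityₜ : ∀ s t x y x′ y′ → t *ᶻ (x *ᶻ y′ -ᶻ x′ *ᶻ y) ≡
    (s *ᶻ x′ +ᶻ t *ᶻ y′) *ᶻ x -ᶻ (s *ᶻ x +ᶻ t *ᶻ y) *ᶻ x′
  identityₜ = ℤSolver.solve-∀
  minor : ∀ x y x′ y′ → s *ᶻ x +ᶻ t *ᶻ y ≡ 0ℤ → s *ᶻ x′ +ᶻ t *ᶻ y′ ≡ 0ℤ → x *ᶻ y′ -ᶻ x′ *ᶻ y ≡ 0ℤ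
  minor x y x′ y′ eq eq′ = [
    (λ s≢0 → *≡0⇒≡0 s≢0 (trans (identityₛ s t x y x′ y′) (cong₂ (λ z z′ → z *ᶻ y′ -ᶻ z′ *ᶻ y) eq eq′))) ,
    (λ t≢0 → *≡0⇒≡0 t≢0 (trans (identityₜ s t x y x′ y′) (cong₂ (λ z z′ → z′ *ᶻ x -ᶻ z *ᶻ x′) eq eq′)))
    ]′ nonzero

-- A common point of the two lines with denominators cleared. Of the positivity of the weights only
-- their nonvanishing at `a` and `b` is kept.
record Crossing (a b c d : ℤ³) : Set where
  field
    α β γ δ : ℤ
    α≢0     : α ≢ 0ℤ
    β≢0     : β ≢ 0ℤ
    weights : α +ᶻ β ≡ γ +ᶻ δ
    meet    : ∀ i → α *ᶻ coord a i +ᶻ β *ᶻ coord b i ≡ γ *ᶻ coord c i +ᶻ δ *ᶻ coord d i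

swapˡ : ∀ {a b c d} → Crossing a b c d → Crossing b a c d
swapˡ {a} {b} x = record
  { α = β ; β = α ; γ = γ ; δ = δ ; α≢0 = β≢0 ; β≢0 = α≢0
  ; weights = trans (ℤ.+-comm β α) weights
  ; meet = λ i → trans (ℤ.+-comm (β *ᶻ coord b i) (α *ᶻ coord a i)) (meet i) }
  where open Crossing x

swapʳ : ∀ {a b c d} → Crossing a b c d → Crossing a b d c
swapʳ {c = c} {d} x = record
  { α = α ; β = β ; γ = δ ; δ = γ ; α≢0 = α≢0 ; β≢0 = β≢0
  ; weights = trans weights (ℤ.+-comm γ δ)
  ; meet = λ i → trans (meet i) (ℤ.+-comm (γ *ᶻ coord c i) (δ *ᶻ coord d i)) }
  where open Crossing x

meet⇒combination≡0 : ∀ α β γ δ a b c d → α +ᶻ β ≡ γ +ᶻ δ →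
  α *ᶻ a +ᶻ β *ᶻ b ≡ γ *ᶻ c +ᶻ δ *ᶻ d →
  α *ᶻ (a -ᶻ d) +ᶻ β *ᶻ (b -ᶻ d) +ᶻ -ᶻ γ *ᶻ (c -ᶻ d) ≡ 0ℤ
meet⇒combination≡0 α β γ δ a b c d weights meet =
  trans (identity α β γ δ a b c d)
    (cong₂ (λ y z → y -ᶻ z *ᶻ d) (ℤ.i≡j⇒i-j≡0 meet) (ℤ.i≡j⇒i-j≡0 weights))
  where
  identity : ∀ α β γ δ a b c d → α *ᶻ (a -ᶻ d) +ᶻ β *ᶻ (b -ᶻ d) +ᶻ -ᶻ γ *ᶻ (c -ᶻ d) ≡
    ((α *ᶻ a +ᶻ β *ᶻ b) -ᶻ (γ *ᶻ c +ᶻ δ *ᶻ d)) -ᶻ ((α +ᶻ β) -ᶻ (γ +ᶻ δ)) *ᶻ d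
  identity = ℤSolver.solve-∀

-- Subtracting the equal total weights times `a` leaves `β (b - a) = δ (d - a)` with `β` nonzero.
crossing-shared⇒collinear : ∀ a b d → Crossing a b a d → Collinear a b d
crossing-shared⇒collinear a b d x = trans (sym (⨯-rotate a b d))
  (combination⇒⨯≡𝟎 β (-ᶻ δ) (b ⊝ a) (d ⊝ a) (inj₁ β≢0) λ i →
    trans (cong₂ (λ y z → β *ᶻ y +ᶻ -ᶻ δ *ᶻ z) (coord-⊝ b a i) (coord-⊝ d a i))
    (trans (identity α β γ δ (coord a i) (coord b i) (coord d i))
      (cong₂ (λ y z → y -ᶻ z *ᶻ coord a i) (ℤ.i≡j⇒i-j≡0 (meet i)) (ℤ.i≡j⇒i-j≡0 weights))))
  where
  open Crossing x
  identity : ∀ α β γ δ a b d → β *ᶻ (b -ᶻ a) +ᶻ -ᶻ δ *ᶻ (d -ᶻ a) ≡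
    ((α *ᶻ a +ᶻ β *ᶻ b) -ᶻ (γ *ᶻ a +ᶻ δ *ᶻ d)) -ᶻ ((α +ᶻ β) -ᶻ (γ +ᶻ δ)) *ᶻ a
  identity = ℤSolver.solve-∀

collinear-swap : ∀ a b c → Collinear a b c → Collinear b a c
collinear-swap a b c = ⨯≡𝟎-sym (a ⊝ c) (b ⊝ c)

-- The quadruples attached to pairs of edges

-- The vertices 0F and 1F are auxiliary. Together with one of them, three collinear points,
-- or two points that coincide, satisfy a linear relation whose weight at 0F and 1F is zero.
pattern ↑ v = suc (suc v)

quad : ∀ {n k} → Graph n k → Fin 4 → Fin k × Fin k → Vec (Fin (2 + n)) 4
quad G i (e , f) with edge G e | edge G f | i
... | a , b | c , d | 0F = ↑ a ∷ ↑ b ∷ 0F ∷ 1F ∷ []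
... | a , b | c , d | 1F = ↑ a ∷ ↑ b ∷ ↑ c ∷ 0F ∷ []
... | a , b | c , d | 2F = ↑ a ∷ ↑ b ∷ ↑ d ∷ 0F ∷ []
... | a , b | c , d | 3F = ↑ a ∷ ↑ b ∷ ↑ c ∷ ↑ d ∷ []

unique? : ∀ {n} (q : Vec (Fin n) 4) → Dec (UniqueVec q)
unique? = allPairs? (λ i j → ¬? (i Fin.≟ j))

-- Independence of the four points requires distinct indices. Pairs of edges sharing an endpoint
-- lose their quadruple of kind `3F` and are treated through collinearity instead.
quads : ∀ {n k} → Graph n k → List (Vec (Fin (2 + n)) 4)
quads {k = k} G = filter unique? (cartesianProductWith (quad G) (allFin 4) (cartesianProduct (allFin k) (allFin k)))

quads-unique : ∀ {n k} (G : Graph n k) {q} → q ∈ quads G → UniqueVec q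
quads-unique {k = k} G q∈ = proj₂ (∈-filter⁻ unique?
  {xs = cartesianProductWith (quad G) (allFin 4) (cartesianProduct (allFin k) (allFin k))} q∈)

length-quads : ∀ {n k} (G : Graph n k) → length (quads G) ≤ 4 * (k * k)
length-quads {k = k} G = ≤-trans
  (length-filter unique? (cartesianProductWith (quad G) (allFin 4) (cartesianProduct (allFin k) (allFin k))))
  (≤-reflexive (trans (length-cartesianProductWith (quad G) (allFin 4) (cartesianProduct (allFin k) (allFin k)))
    (cong (4 *_) (trans (length-cartesianProductWith _,_ (allFin k) (allFin k))
      (cong₂ _*_ (length-tabulate {n = k} id) (length-tabulate {n = k} id))))))

-- Geometry of a generic placement

module _ {n k M : ℕ} {{_ : NonZero M}} (G : Graph n k) (X Y Z : Vec (Fin M) (2 + n))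
         (generic : Generic M (quads G) X Y Z) where

  ι : Vec (Fin M) (2 + n) → Fin (2 + n) → ℤ
  ι V i = + toℕ (lookup V i)

  point : Fin n → ℤ³
  point v = ι X (↑ v) , ι Y (↑ v) , ι Z (↑ v)

  private
    ↑≢ : {a b : Fin n} → a ≢ b → _≢_ {A = Fin (2 + n)} (↑ a) (↑ b)
    ↑≢ a≢b = a≢b ∘ Fin.suc-injective ∘ Fin.suc-injective

    1≤M : 1 ≤ M
    1≤M = >-nonZero⁻¹ M

    columns : Vec (Fin (2 + n)) 4 → Set
    columns q = NoCommonPlane M (diff (pick X q)) (diff (pick Y q)) (diff (pick Z q))

    generic-quad : ∀ i e f → UniqueVec (quad G i (e , f)) → columns (quad G i (e , f))
    generic-quad i e f u = generic (∈-filter⁺ unique?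
      (∈-cartesianProductWith⁺ (quad G) (∈-allFin i) (∈-cartesianProduct⁺ (∈-allFin e) (∈-allFin f))) u)

    plane₀ : ∀ e {a b} → edge G e ≡ (a , b) → columns (↑ a ∷ ↑ b ∷ 0F ∷ 1F ∷ [])
    plane₀ e {a} {b} eq with edge G e | loopless G e | generic-quad 0F e e
    plane₀ e refl | a , b | a≢b | use = use
      ((↑≢ a≢b VAll.∷ (λ ()) VAll.∷ (λ ()) VAll.∷ VAll.[]) ∷
       ((λ ()) VAll.∷ (λ ()) VAll.∷ VAll.[]) ∷ ((λ ()) VAll.∷ VAll.[]) ∷ VAll.[] ∷ [])

    plane₁ : ∀ e f {a b c d} → edge G e ≡ (a , b) → edge G f ≡ (c , d) → c ≢ a → c ≢ b →
      columns (↑ a ∷ ↑ b ∷ ↑ c ∷ 0F ∷ [])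
    plane₁ e f eqe eqf c≢a c≢b with edge G e | edge G f | loopless G e | generic-quad 1F e f
    plane₁ e f refl refl c≢a c≢b | a , b | c , d | a≢b | use = use
      ((↑≢ a≢b VAll.∷ ↑≢ (c≢a ∘ sym) VAll.∷ (λ ()) VAll.∷ VAll.[]) ∷
       (↑≢ (c≢b ∘ sym) VAll.∷ (λ ()) VAll.∷ VAll.[]) ∷ ((λ ()) VAll.∷ VAll.[]) ∷ VAll.[] ∷ [])

    plane₂ : ∀ e f {a b c d} → edge G e ≡ (a , b) → edge G f ≡ (c , d) → d ≢ a → d ≢ b →
      columns (↑ a ∷ ↑ b ∷ ↑ d ∷ 0F ∷ [])
    plane₂ e f eqe eqf c≢a c≢b with edge G e | edge G f | loopless G e | generic-quad 2F e f
    plane₂ e f refl refl c≢a c≢b | a , b | c , d | a≢b | use = use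
      ((↑≢ a≢b VAll.∷ ↑≢ (c≢a ∘ sym) VAll.∷ (λ ()) VAll.∷ VAll.[]) ∷
       (↑≢ (c≢b ∘ sym) VAll.∷ (λ ()) VAll.∷ VAll.[]) ∷ ((λ ()) VAll.∷ VAll.[]) ∷ VAll.[] ∷ [])

    plane₃ : ∀ e f {a b c d} → edge G e ≡ (a , b) → edge G f ≡ (c , d) →
      a ≢ c → a ≢ d → b ≢ c → b ≢ d → columns (↑ a ∷ ↑ b ∷ ↑ c ∷ ↑ d ∷ [])
    plane₃ e f eqe eqf a≢c a≢d b≢c b≢d
      with edge G e | edge G f | loopless G e | loopless G f | generic-quad 3F e f
    plane₃ e f refl refl a≢c a≢d b≢c b≢d | a , b | c , d | a≢b | c≢d | use = use
      ((↑≢ a≢b VAll.∷ ↑≢ a≢c VAll.∷ ↑≢ a≢d VAll.∷ VAll.[]) ∷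
       (↑≢ b≢c VAll.∷ ↑≢ b≢d VAll.∷ VAll.[]) ∷ (↑≢ c≢d VAll.∷ VAll.[]) ∷ VAll.[] ∷ [])

    -- Weights orthogonal to `𝟏` sum to zero, so the reference values `o` and `o′` drop out. What
    -- remains is one component of the cross product by which `Collinear` is defined.
    minor : ∀ a b c o a′ b′ c′ o′ →
      (𝟏 ⨯ (a -ᶻ o , b -ᶻ o , c -ᶻ o)) ∙ (a′ -ᶻ o′ , b′ -ᶻ o′ , c′ -ᶻ o′) ≡
      (a -ᶻ c) *ᶻ (b′ -ᶻ c′) -ᶻ (a′ -ᶻ c′) *ᶻ (b -ᶻ c)
    minor = identity
      where
      -- The left-hand side unfolded, as the solver does not see through 𝟏, ⨯ and ∙.
      identity : ∀ a b c o a′ b′ c′ o′ →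
        (1ℤ *ᶻ (c -ᶻ o) -ᶻ 1ℤ *ᶻ (b -ᶻ o)) *ᶻ (a′ -ᶻ o′) +ᶻ
        (1ℤ *ᶻ (a -ᶻ o) -ᶻ 1ℤ *ᶻ (c -ᶻ o)) *ᶻ (b′ -ᶻ o′) +ᶻ
        (1ℤ *ᶻ (b -ᶻ o) -ᶻ 1ℤ *ᶻ (a -ᶻ o)) *ᶻ (c′ -ᶻ o′) ≡
        (a -ᶻ c) *ᶻ (b′ -ᶻ c′) -ᶻ (a′ -ᶻ c′) *ᶻ (b -ᶻ c)
      identity = ℤSolver.solve-∀

    𝟏⨯≡𝟎⇒≡ : ∀ a b c o → 𝟏 ⨯ (a -ᶻ o , b -ᶻ o , c -ᶻ o) ≡ 𝟎 → a ≡ b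
    𝟏⨯≡𝟎⇒≡ a b c o eq = sym (ℤ.i-j≡0⇒i≡j b a (trans (identity a b o) (cong (proj₂ ∘ proj₂) eq)))
      where
      identity : ∀ a b o → b -ᶻ a ≡ 1ℤ *ᶻ (b -ᶻ o) -ᶻ 1ℤ *ᶻ (a -ᶻ o)
      identity = ℤSolver.solve-∀

  edge-nondegenerate : ∀ e {a b} → edge G e ≡ (a , b) → point a ≢ point b
  -- The cross product of these two vectors is (1, -1, 0), the relation saying that the first two
  -- points coincide.
  edge-nondegenerate e {a} {b} eq a≡b = plane₀ e eq (1ℤ , 1ℤ , 0ℤ) (0ℤ , 0ℤ , 1ℤ) 1≤M 1≤M (λ ())
    (vanish (ι X 1F) (ι X 0F) (cong proj₁ a≡b))
    (vanish (ι Y 1F) (ι Y 0F) (cong (proj₁ ∘ proj₂) a≡b))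
    (vanish (ι Z 1F) (ι Z 0F) (cong (proj₂ ∘ proj₂) a≡b))
    where
    vanish : ∀ {x y} o c → x ≡ y →
      ((1ℤ , 1ℤ , 0ℤ) ⨯ (0ℤ , 0ℤ , 1ℤ)) ∙ (x -ᶻ o , y -ᶻ o , c -ᶻ o) ≡ 0ℤ
    vanish {x} o c refl = identity x o c
      where
      identity : ∀ x o c → 1ℤ *ᶻ (x -ᶻ o) +ᶻ -[1+ 0 ] *ᶻ (x -ᶻ o) +ᶻ 0ℤ *ᶻ (c -ᶻ o) ≡ 0ℤ
      identity = ℤSolver.solve-∀

  private
    -- Collinearity makes every `𝟏 ⨯ column` orthogonal to all columns, so genericity makes each
    -- column a multiple of `𝟏`; then the endpoints of the edge coincide.
    noncollinear : ∀ e {a b} c → edge G e ≡ (a , b) → columns (↑ a ∷ ↑ b ∷ ↑ c ∷ 0F ∷ []) →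
      ¬ Collinear (point a) (point b) (point c)
    noncollinear e {a} {b} c eq no-plane coll = edge-nondegenerate e eq
      (triple-≡ (𝟏⨯≡𝟎⇒≡ (ι X (↑ a)) (ι X (↑ b)) (ι X (↑ c)) (ι X 0F) (proj₁ parallel))
                (𝟏⨯≡𝟎⇒≡ (ι Y (↑ a)) (ι Y (↑ b)) (ι Y (↑ c)) (ι Y 0F) (proj₁ (proj₂ parallel)))
                (𝟏⨯≡𝟎⇒≡ (ι Z (↑ a)) (ι Z (↑ b)) (ι Z (↑ c)) (ι Z 0F) (proj₂ (proj₂ parallel))))
      where
      q : Vec (Fin (2 + n)) 4
      q = ↑ a ∷ ↑ b ∷ ↑ c ∷ 0F ∷ []
      minor-ι : ∀ V W → (𝟏 ⨯ diff (pick V q)) ∙ diff (pick W q) ≡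
        (ι V (↑ a) -ᶻ ι V (↑ c)) *ᶻ (ι W (↑ b) -ᶻ ι W (↑ c)) -ᶻ
        (ι W (↑ a) -ᶻ ι W (↑ c)) *ᶻ (ι V (↑ b) -ᶻ ι V (↑ c))
      minor-ι V W = minor (ι V (↑ a)) (ι V (↑ b)) (ι V (↑ c)) (ι V 0F) (ι W (↑ a)) (ι W (↑ b)) (ι W (↑ c)) (ι W 0F)
      parallel = coplanar⇒parallel no-plane (‖diff‖ (pick X q)) (‖diff‖ (pick Y q)) (‖diff‖ (pick Z q)) 𝟏 1≤M
        (trans (minor-ι X Y) (cong (proj₂ ∘ proj₂) coll))
        (trans (minor-ι Y Z) (cong proj₁ coll))
        (trans (minor-ι Z X) (cong (proj₁ ∘ proj₂) coll))

  endpoint-noncollinear : ∀ e f {a b c d v} → edge G e ≡ (a , b) → edge G f ≡ (c , d) →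
    v ≡ c ⊎ v ≡ d → v ≢ a → v ≢ b → ¬ Collinear (point a) (point b) (point v)
  endpoint-noncollinear e f {v = v} eqe eqf (inj₁ refl) v≢a v≢b = noncollinear e v eqe (plane₁ e f eqe eqf v≢a v≢b)
  endpoint-noncollinear e f {v = v} eqe eqf (inj₂ refl) v≢a v≢b = noncollinear e v eqe (plane₂ e f eqe eqf v≢a v≢b)

  private
    -- The weights `(α , β , -ᶻ γ)` annihilate every column, so the determinant vanishes. Genericity
    -- then leaves only rank at most one, that is, collinear points.
    disjoint-crossing⇒collinear : ∀ e f {a b c d} → edge G e ≡ (a , b) → edge G f ≡ (c , d) →
      a ≢ c → a ≢ d → b ≢ c → b ≢ d → Crossing (point a) (point b) (point c) (point d) →
      Collinear (point a) (point b) (point c)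
    disjoint-crossing⇒collinear e f {a} {b} {c} {d} eqe eqf a≢c a≢d b≢c b≢d x = triple-≡
      (component Y Z (proj₁ (proj₂ parallel))) (component Z X (proj₂ (proj₂ parallel)))
      (component X Y (proj₁ parallel))
      where
      open Crossing x
      q : Vec (Fin (2 + n)) 4
      q = ↑ a ∷ ↑ b ∷ ↑ c ∷ ↑ d ∷ []
      column : ∀ V → α *ᶻ ι V (↑ a) +ᶻ β *ᶻ ι V (↑ b) ≡ γ *ᶻ ι V (↑ c) +ᶻ δ *ᶻ ι V (↑ d) →
        (α , β , -ᶻ γ) ∙ diff (pick V q) ≡ 0ℤ
      column V = meet⇒combination≡0 α β γ δ (ι V (↑ a)) (ι V (↑ b)) (ι V (↑ c)) (ι V (↑ d)) weights
      parallel = singular⇒parallel (plane₃ e f eqe eqf a≢c a≢d b≢c b≢d)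
        (‖diff‖ (pick X q)) (‖diff‖ (pick Y q)) (‖diff‖ (pick Z q))
        (⊥⇒⨯∙≡0 (α , β , -ᶻ γ) (diff (pick X q)) (diff (pick Y q)) (diff (pick Z q)) α≢0
          (column X (meet 0F)) (column Y (meet 1F)) (column Z (meet 2F)))
      component : ∀ V W → diff (pick V q) ⨯ diff (pick W q) ≡ 𝟎 →
        (ι V (↑ a) -ᶻ ι V (↑ c)) *ᶻ (ι W (↑ b) -ᶻ ι W (↑ c)) -ᶻ
        (ι W (↑ a) -ᶻ ι W (↑ c)) *ᶻ (ι V (↑ b) -ᶻ ι V (↑ c)) ≡ 0ℤ
      component V W V⨯W≡𝟎 = begin
        _                                            ≡⟨ minor (ι V (↑ a)) (ι V (↑ b)) (ι V (↑ c)) (ι V (↑ d))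
                                                          (ι W (↑ a)) (ι W (↑ b)) (ι W (↑ c)) (ι W (↑ d)) ⟨
        (𝟏 ⨯ diff (pick V q)) ∙ diff (pick W q)      ≡⟨ ⨯∙-rotate 𝟏 (diff (pick V q)) (diff (pick W q)) ⟩
        (diff (pick V q) ⨯ diff (pick W q)) ∙ 𝟏      ≡⟨ cong (_∙ 𝟏) V⨯W≡𝟎 ⟩
        0ℤ                                           ∎
        where open ≡-Reasoning

  edges-noncrossing : ∀ e f {a b c d} → e ≢ f → edge G e ≡ (a , b) → edge G f ≡ (c , d) →
    ¬ Crossing (point a) (point b) (point c) (point d)
  edges-noncrossing e f {a} {b} {c} {d} e≢f eqe eqf x = cases (a Fin.≟ c) (a Fin.≟ d) (b Fin.≟ c) (b Fin.≟ d)
    where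
    a≢b : a ≢ b
    a≢b = subst (λ (a , b) → a ≢ b) eqe (loopless G e)
    c≢d : c ≢ d
    c≢d = subst (λ (c , d) → c ≢ d) eqf (loopless G f)
    not-same : ¬ SameEdge (a , b) (c , d)
    not-same = e≢f ∘ distinct G e f ∘ subst₂ SameEdge (sym eqe) (sym eqf)
    meets-c = endpoint-noncollinear e f {v = c} eqe eqf (inj₁ refl)
    meets-d = endpoint-noncollinear e f {v = d} eqe eqf (inj₂ refl)
    cases : Dec (a ≡ c) → Dec (a ≡ d) → Dec (b ≡ c) → Dec (b ≡ d) → ⊥
    cases (yes a≡c) _ _ _ = meets-d (λ d≡a → c≢d (trans (sym a≡c) (sym d≡a))) (λ d≡b → not-same (inj₁ (a≡c , sym d≡b)))
      (crossing-shared⇒collinear (point a) (point b) (point d)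
        (subst (λ v → Crossing (point a) (point b) (point v) (point d)) (sym a≡c) x))
    cases _ (yes a≡d) _ _ = meets-c (λ c≡a → c≢d (trans c≡a a≡d)) (λ c≡b → not-same (inj₂ (a≡d , sym c≡b)))
      (crossing-shared⇒collinear (point a) (point b) (point c)
        (swapʳ (subst (λ v → Crossing (point a) (point b) (point c) (point v)) (sym a≡d) x)))
    cases _ _ (yes b≡c) _ = meets-d (λ d≡a → not-same (inj₂ (sym d≡a , b≡c))) (λ d≡b → c≢d (trans (sym b≡c) (sym d≡b)))
      (collinear-swap (point b) (point a) (point d) (crossing-shared⇒collinear (point b) (point a) (point d)
        (subst (λ v → Crossing (point b) (point a) (point v) (point d)) (sym b≡c) (swapˡ x))))
    cases _ _ _ (yes b≡d) = meets-c (λ c≡a → not-same (inj₁ (sym c≡a , b≡d))) (λ c≡b → c≢d (trans c≡b b≡d))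
      (collinear-swap (point b) (point a) (point c) (crossing-shared⇒collinear (point b) (point a) (point c)
        (swapʳ (subst (λ v → Crossing (point b) (point a) (point c) (point v)) (sym b≡d) (swapˡ x)))))
    cases (no a≢c) (no a≢d) (no b≢c) (no b≢d) = meets-c (a≢c ∘ sym) (b≢c ∘ sym)
      (disjoint-crossing⇒collinear e f eqe eqf a≢c a≢d b≢c b≢d x)

-- Choice of the side of the cube

n≤2^⌈log₂n⌉ : ∀ n → n ≤ 2 ^ ⌈log₂ n ⌉
n≤2^⌈log₂n⌉ = <-rec (λ n → n ≤ 2 ^ ⌈log₂ n ⌉) step
  where
  step : ∀ n → (∀ {m} → m < n → m ≤ 2 ^ ⌈log₂ m ⌉) → n ≤ 2 ^ ⌈log₂ n ⌉
  step 0 _ = z≤n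
  step 1 _ = m^n>0 2 ⌈log₂ 1 ⌉
  step n@(suc (suc n-2)) rec = begin
    n                                ≡⟨ ⌊n/2⌋+⌈n/2⌉≡n n ⟨
    ⌊ n /2⌋ + ⌈ n /2⌉                ≤⟨ +-monoˡ-≤ ⌈ n /2⌉ (⌊n/2⌋≤⌈n/2⌉ n) ⟩
    ⌈ n /2⌉ + ⌈ n /2⌉                ≡⟨ cong₂ _+_ {x = ⌈ n /2⌉} refl (+-identityʳ ⌈ n /2⌉) ⟨
    2 * ⌈ n /2⌉                      ≤⟨ *-monoʳ-≤ 2 (rec (⌈n/2⌉<n n-2)) ⟩
    2 ^ suc ⌈log₂ ⌈ n /2⌉ ⌉          ≡⟨ cong (λ l → 2 ^ suc l) (⌈log₂⌈n/2⌉⌉≡⌈log₂n⌉∸1 n) ⟩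
    2 ^ suc (⌈log₂ n ⌉ ∸ 1)          ≡⟨ cong (2 ^_) (m+[n∸m]≡n (⌈log₂⌉-mono-≤ {2} {n} (s≤s (s≤s z≤n)))) ⟩
    2 ^ ⌈log₂ n ⌉                    ∎
    where open ≤-Reasoning

[2^r]³≡8^r : ∀ r → (2 ^ r) ^ 3 ≡ 8 ^ r
[2^r]³≡8^r r = begin
  (2 ^ r) ^ 3  ≡⟨ ^-*-assoc 2 r 3 ⟩
  2 ^ (r * 3)  ≡⟨ cong (2 ^_) (*-comm r 3) ⟩
  2 ^ (3 * r)  ≡⟨ ^-*-assoc 2 3 r ⟨
  8 ^ r        ∎
  where open ≡-Reasoning

^-cancelʳ-≤ : ∀ b → 2 ≤ b → ∀ {i j} → b ^ i ≤ b ^ j → i ≤ j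
^-cancelʳ-≤ b 2≤b bⁱ≤bʲ = ≮⇒≥ λ j<i → <⇒≱ (^-monoʳ-< b 2≤b j<i) bⁱ≤bʲ

n<2^n : ∀ n → n < 2 ^ n
n<2^n zero    = ≤-refl
n<2^n (suc n) = begin-strict
  suc n            <⟨ s≤s (n<2^n n) ⟩
  1 + 2 ^ n        ≤⟨ +-monoˡ-≤ (2 ^ n) (m^n>0 2 n) ⟩
  2 ^ n + 2 ^ n    ≡⟨ cong₂ _+_ {x = 2 ^ n} refl (+-identityʳ (2 ^ n)) ⟨
  2 ^ suc n        ∎
  where open ≤-Reasoning

-- A cube of side 2 ^ r inside the grid for the non-isolated vertices; the relations to be
-- avoided have norm below 2 ^ J.
record GridSize (Q K n m : ℕ) : Set where
  field
    r      : ℕ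
    J      : ℕ
    4M²<2ᴶ : 4 * (2 ^ r * 2 ^ r) < 2 ^ J
    few    : Q * J * K < (2 ^ r) ^ 3
    M≤m    : 2 ^ r ≤ m
    room   : n ≤ m * (m * (m ∸ 2 ^ r))

-- The volume is `8 ^ c` times a power of 8 within a factor 8 of `k * k * suc L`. Raising `c`
-- multiplies the volume exponentially but lengthens the range of scales only linearly, `J` being at
-- most `(2 * c + 5) * suc L`; hence the condition on `c`. The successor matters at `k = 1`, where
-- the logarithm vanishes.
∃gridSize : ∀ c K → 4 * (2 * c + 5) * K < 8 ^ c →
  ∀ n k m Q → 1 ≤ n → 1 ≤ k → Q ≤ 4 * (k * k) →
  2 * 8 ^ (2 + c) * (n * k + k * k * ⌈log₂ k ⌉) ≤ m ^ 3 → GridSize Q K n m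
∃gridSize c K K<8ᶜ n k m Q 1≤n 1≤k Q≤4k² large
  with ∃power 8 (s≤s (s≤s z≤n)) (k * k * suc ⌈log₂ k ⌉) (*-mono-≤ (*-mono-≤ 1≤k 1≤k) (s≤s z≤n))
... | ρ , ν≤8^ρ , 8^ρ≤8ν = record
  { r = c + ρ ; J = 3 + 2 * (c + ρ) ; 4M²<2ᴶ = wide ; few = few
  ; M≤m = ≤-trans (m≤m+n M (M + 0)) 2M≤m ; room = room }
  where
  open ≤-Reasoning
  L = ⌈log₂ k ⌉
  ν = k * k * suc L
  M = 2 ^ (c + ρ)
  S = n * k + k * k * L
  wide : 4 * (M * M) < 2 ^ (3 + 2 * (c + ρ))
  wide = begin-strict
    4 * (M * M)                      ≡⟨ cong (4 *_) (trans
                                          (cong (2 ^_) (cong₂ _+_ {x = c + ρ} refl (+-identityʳ (c + ρ))))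
                                          (^-distribˡ-+-* 2 (c + ρ) (c + ρ))) ⟨
    4 * 2 ^ (2 * (c + ρ))            ≡⟨ ^-distribˡ-+-* 2 2 (2 * (c + ρ)) ⟨
    2 ^ (2 + 2 * (c + ρ))            <⟨ ^-monoʳ-< 2 ≤-refl (n<1+n (2 + 2 * (c + ρ))) ⟩
    2 ^ (3 + 2 * (c + ρ))            ∎
  ρ≤1+L : ρ ≤ suc L
  ρ≤1+L = ^-cancelʳ-≤ 8 (s≤s (s≤s z≤n)) (begin
    8 ^ ρ                            ≤⟨ 8^ρ≤8ν ⟩
    8 * (k * k * suc L)              ≤⟨ *-monoʳ-≤ 8 (*-mono-≤ (*-mono-≤ k≤2ᴸ k≤2ᴸ) (n<2^n L)) ⟩
    8 * (2 ^ L * 2 ^ L * 2 ^ L)      ≡⟨ cong (8 *_) (trans (cube (2 ^ L)) ([2^r]³≡8^r L)) ⟩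
    8 * 8 ^ L                        ∎)
    where
    k≤2ᴸ = n≤2^⌈log₂n⌉ k
    cube : ∀ x → x * x * x ≡ x * (x * (x * 1))
    cube = solve-∀
  J≤ : 3 + 2 * (c + ρ) ≤ (2 * c + 5) * suc L
  J≤ = begin
    3 + 2 * (c + ρ)                        ≤⟨ +-monoʳ-≤ 3 (*-monoʳ-≤ 2 (+-monoʳ-≤ c ρ≤1+L)) ⟩
    3 + 2 * (c + suc L)                    ≤⟨ m≤m+n _ (2 * c * L + 3 * L) ⟩
    3 + 2 * (c + suc L) + (2 * c * L + 3 * L)   ≡⟨ expand c L ⟩
    (2 * c + 5) * suc L                    ∎
    where
    expand : ∀ c L → 3 + 2 * (c + (1 + L)) + (2 * c * L + 3 * L) ≡ (2 * c + 5) * (1 + L)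
    expand = solve-∀
  few : Q * (3 + 2 * (c + ρ)) * K < M ^ 3
  few = begin-strict
    Q * (3 + 2 * (c + ρ)) * K                  ≤⟨ *-monoˡ-≤ K (*-mono-≤ Q≤4k² J≤) ⟩
    4 * (k * k) * ((2 * c + 5) * suc L) * K    ≡⟨ regroup k c (suc L) K ⟩
    4 * (2 * c + 5) * K * ν                    ≤⟨ *-monoʳ-≤ (4 * (2 * c + 5) * K) ν≤8^ρ ⟩
    4 * (2 * c + 5) * K * 8 ^ ρ                <⟨ *-monoˡ-< (8 ^ ρ) {{m^n≢0 8 ρ}} K<8ᶜ ⟩
    8 ^ c * 8 ^ ρ                              ≡⟨ ^-distribˡ-+-* 8 c ρ ⟨
    8 ^ (c + ρ)                                ≡⟨ [2^r]³≡8^r (c + ρ) ⟨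
    M ^ 3                                      ∎
    where
    regroup : ∀ k c l K → 4 * (k * k) * ((2 * c + 5) * l) * K ≡ 4 * (2 * c + 5) * K * (k * k * l)
    regroup = solve-∀
  -- If the logarithm is zero then `k` is at most 1 and `n * k` covers `k * k`; otherwise the second
  -- term does.
  k²≤S : k * k ≤ S
  k²≤S = bound L (n≤2^⌈log₂n⌉ k)
    where
    bound : ∀ l → k ≤ 2 ^ l → k * k ≤ n * k + k * k * l
    bound zero    k≤1 = ≤-trans (*-monoˡ-≤ k (≤-trans k≤1 1≤n)) (m≤m+n (n * k) _)
    bound (suc l) _   = ≤-trans (m≤m*n (k * k) (suc l)) (m≤n+m _ (n * k))
  ν≤2S : ν ≤ 2 * S
  ν≤2S = begin
    k * k * suc L          ≡⟨ *-suc (k * k) L ⟩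
    k * k + k * k * L      ≤⟨ +-mono-≤ k²≤S (m≤n+m (k * k * L) (n * k)) ⟩
    S + S                  ≡⟨ cong₂ _+_ {x = S} refl (+-identityʳ S) ⟨
    2 * S                  ∎
  -- The constant of the theorem arises here: 8 from doubling `M`, `8 ^ c` from the choice of the
  -- volume, 8 from rounding to a power of 8, and 2 from `ν≤2S`. The doubling leaves at least half
  -- of the grid outside the cube.
  2M≤m : 2 * M ≤ m
  2M≤m = ≮⇒≥ λ m<2M → <⇒≱ (^-monoˡ-< 3 m<2M) (begin
    (2 * M) ^ 3                       ≡⟨ cube M ⟩
    8 * M ^ 3                         ≡⟨ cong (8 *_) (trans ([2^r]³≡8^r (c + ρ)) (^-distribˡ-+-* 8 c ρ)) ⟩
    8 * (8 ^ c * 8 ^ ρ)               ≤⟨ *-monoʳ-≤ 8 (*-monoʳ-≤ (8 ^ c) (≤-trans 8^ρ≤8ν (*-monoʳ-≤ 8 ν≤2S))) ⟩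
    8 * (8 ^ c * (8 * (2 * S)))       ≡⟨ regroup (8 ^ c) S ⟩
    2 * (8 * (8 * 8 ^ c)) * S         ≤⟨ large ⟩
    m ^ 3                             ∎)
    where
    cube : ∀ x → 2 * x * (2 * x * (2 * x * 1)) ≡ 8 * (x * (x * (x * 1)))
    cube = solve-∀
    regroup : ∀ e s → 8 * (e * (8 * (2 * s))) ≡ 2 * (8 * (8 * e)) * s
    regroup = solve-∀
  m≤2[m∸M] : m ≤ 2 * (m ∸ M)
  m≤2[m∸M] = begin
    m                    ≡⟨ m+[n∸m]≡n (≤-trans (m≤m+n M (M + 0)) 2M≤m) ⟨
    M + (m ∸ M)          ≤⟨ +-monoˡ-≤ (m ∸ M) (m+n≤o⇒m≤o∸n M (subst (_≤ m) (cong₂ _+_ {x = M} refl (+-identityʳ M)) 2M≤m)) ⟩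
    m ∸ M + (m ∸ M)      ≡⟨ cong₂ _+_ {x = m ∸ M} refl (+-identityʳ (m ∸ M)) ⟨
    2 * (m ∸ M)          ∎
  room : n ≤ m * (m * (m ∸ M))
  room = *-cancelˡ-≤ 2 (begin
    2 * n                             ≤⟨ *-mono-≤ (m≤m*n 2 (8 ^ (2 + c)) {{m^n≢0 8 (2 + c)}})
                                           (≤-trans (m≤m*n n k {{>-nonZero 1≤k}}) (m≤m+n (n * k) _)) ⟩
    2 * 8 ^ (2 + c) * S               ≤⟨ large ⟩
    m ^ 3                             ≤⟨ *-monoʳ-≤ m (*-monoʳ-≤ m (≤-trans (≤-reflexive (*-identityʳ m)) m≤2[m∸M])) ⟩
    m * (m * (2 * (m ∸ M)))           ≡⟨ regroup m (m ∸ M) ⟩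
    2 * (m * (m * (m ∸ M)))           ∎)
    where
    regroup : ∀ m d → m * (m * (2 * d)) ≡ 2 * (m * (m * d))
    regroup = solve-∀

-- From a generic placement to a grid-drawing

embed : ∀ {m} → Point m → ℤ³
embed p = + px p , + py p , + pz p

onSegment⇒collinear : ∀ {m} (a b p : Point m) → OnSegment a b p → Collinear (embed a) (embed b) (embed p)
onSegment⇒collinear a b p (s , t , 1≤s+t , eqx , eqy , eqz) =
  combination⇒⨯≡𝟎 (+ s) (+ t) (embed a ⊝ embed p) (embed b ⊝ embed p) (nonzero s t 1≤s+t) λ where
    0F → balance (px a) (px b) (px p) eqx
    1F → balance (py a) (py b) (py p) eqy
    2F → balance (pz a) (pz b) (pz p) eqz
  where
  nonzero : ∀ s t → 1 ≤ s + t → + s ≢ 0ℤ ⊎ + t ≢ 0ℤ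
  nonzero (suc s) t       _ = inj₁ λ ()
  nonzero zero    (suc t) _ = inj₂ λ ()
  balance : ∀ x y z → (s + t) * z ≡ s * x + t * y → + s *ᶻ (+ x -ᶻ + z) +ᶻ + t *ᶻ (+ y -ᶻ + z) ≡ 0ℤ
  balance x y z eq = trans (identity (+ s) (+ t) (+ x) (+ y) (+ z)) (ℤ.i≡j⇒i-j≡0 (begin
    + s *ᶻ + x +ᶻ + t *ᶻ + y      ≡⟨ cong₂ _+ᶻ_ (ℤ.pos-* s x) (ℤ.pos-* t y) ⟨
    + (s * x + t * y)             ≡⟨ cong +_ eq ⟨
    + ((s + t) * z)               ≡⟨ ℤ.pos-* (s + t) z ⟩
    (+ s +ᶻ + t) *ᶻ + z           ∎))
    where
    open ≡-Reasoning
    identity : ∀ s t x y z → s *ᶻ (x -ᶻ z) +ᶻ t *ᶻ (y -ᶻ z) ≡ (s *ᶻ x +ᶻ t *ᶻ y) -ᶻ (s +ᶻ t) *ᶻ z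
    identity = ℤSolver.solve-∀

shareInterior⇒crossing : ∀ {m} (a b c d : Point m) → ShareInteriorPoint a b c d →
  Crossing (embed a) (embed b) (embed c) (embed d)
shareInterior⇒crossing a b c d (s , t , s′ , t′ , 1≤s , 1≤t , 1≤s′ , 1≤t′ , eqx , eqy , eqz) = record
  { α = + ((s′ + t′) * s) ; β = + ((s′ + t′) * t) ; γ = + ((s + t) * s′) ; δ = + ((s + t) * t′)
  ; α≢0 = positive 1≤s ; β≢0 = positive 1≤t
  ; weights = cong +_ (weights s t s′ t′)
  ; meet = λ where
      0F → meet (px a) (px b) (px c) (px d) eqx
      1F → meet (py a) (py b) (py c) (py d) eqy
      2F → meet (pz a) (pz b) (pz c) (pz d) eqz }
  where
  positive : ∀ {u} → 1 ≤ u → + ((s′ + t′) * u) ≢ 0ℤ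
  positive 1≤u eq = <⇒≢ (*-mono-≤ (≤-trans 1≤s′ (m≤m+n s′ t′)) 1≤u) (sym (ℤ.+-injective eq))
  weights : ∀ s t s′ t′ → (s′ + t′) * s + (s′ + t′) * t ≡ (s + t) * s′ + (s + t) * t′
  weights = solve-∀
  split : ∀ w s t x y → + (w * s) *ᶻ + x +ᶻ + (w * t) *ᶻ + y ≡ + (w * (s * x + t * y))
  split w s t x y = trans (sym (cong₂ _+ᶻ_ (ℤ.pos-* (w * s) x) (ℤ.pos-* (w * t) y)))
    (cong +_ (identity w s t x y))
    where
    identity : ∀ w s t x y → w * s * x + w * t * y ≡ w * (s * x + t * y)
    identity = solve-∀
  meet : ∀ x y z w → (s′ + t′) * (s * x + t * y) ≡ (s + t) * (s′ * z + t′ * w) →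
    + ((s′ + t′) * s) *ᶻ + x +ᶻ + ((s′ + t′) * t) *ᶻ + y ≡
    + ((s + t) * s′) *ᶻ + z +ᶻ + ((s + t) * t′) *ᶻ + w
  meet x y z w eq = trans (split (s′ + t′) s t x y) (trans (cong +_ eq) (sym (split (s + t) s′ t′ z w)))

module _ {n k M m : ℕ} {{_ : NonZero M}} (G : Graph n k) (X Y Z : Vec (Fin M) (2 + n))
         (generic : Generic M (quads G) X Y Z) (M≤m : M ≤ m) (room : n ≤ m * (m * (m ∸ M))) where

  private
    P : Fin n → ℤ³
    P = point G X Y Z generic

  Endpoint : Fin n → Set
  Endpoint v = ∃[ e ] (v ≡ proj₁ (edge G e) ⊎ v ≡ proj₂ (edge G e))

  endpoint? : ∀ v → Dec (Endpoint v)
  endpoint? v = Fin.any? λ e → (v Fin.≟ proj₁ (edge G e)) ⊎-dec (v Fin.≟ proj₂ (edge G e))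

  inner : Fin n → Point m
  inner v = inject≤ (lookup X (↑ v)) M≤m , inject≤ (lookup Y (↑ v)) M≤m , inject≤ (lookup Z (↑ v)) M≤m

  -- Isolated vertices go to the slab z ≥ M, which no edge meets.
  outer : Fin n → Point m
  outer v = proj₁ x,yz , proj₁ y,z , cast (m+[n∸m]≡n M≤m) (M ↑ʳ proj₂ y,z)
    where
    x,yz = remQuot {m} (m * (m ∸ M)) (inject≤ v room)
    y,z  = remQuot {m} (m ∸ M) (proj₂ x,yz)

  place : ∀ v → Dec (Endpoint v) → Point m
  place v (yes _) = inner v
  place v (no  _) = outer v

  position : Fin n → Point m
  position v = place v (endpoint? v)

  embed-inner : ∀ v → embed (inner v) ≡ P v
  embed-inner v = triple-≡ (cong +_ (Fin.toℕ-inject≤ (lookup X (↑ v)) M≤m))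
    (cong +_ (Fin.toℕ-inject≤ (lookup Y (↑ v)) M≤m)) (cong +_ (Fin.toℕ-inject≤ (lookup Z (↑ v)) M≤m))

  inner-low : ∀ v → pz (inner v) < M
  inner-low v = subst (_< M) (sym (Fin.toℕ-inject≤ (lookup Z (↑ v)) M≤m)) (Fin.toℕ<n (lookup Z (↑ v)))

  outer-high : ∀ v → M ≤ pz (outer v)
  outer-high v = subst (M ≤_) (sym (trans (Fin.toℕ-cast _ (M ↑ʳ z)) (Fin.toℕ-↑ʳ M z))) (m≤m+n M (toℕ z))
    where
    z = proj₂ (remQuot {m} (m ∸ M) (proj₂ (remQuot {m} (m * (m ∸ M)) (inject≤ v room))))

  place-endpoint : ∀ {v} → Endpoint v → ∀ d → place v d ≡ inner v
  place-endpoint _  (yes _)  = refl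
  place-endpoint ve (no ¬ve) = contradiction ve ¬ve

  outer-injective : ∀ u v → outer u ≡ outer v → u ≡ v
  outer-injective u v eq = Fin.inject≤-injective room room u v (remQuot-injective {m} (m * (m ∸ M)) _ _
    (cong₂ _,_ (cong proj₁ eq) (remQuot-injective {m} (m ∸ M) _ _ (cong₂ _,_ (cong (proj₁ ∘ proj₂) eq)
      (Fin.↑ʳ-injective M _ _ (cast-injective (m+[n∸m]≡n M≤m) (cong (proj₂ ∘ proj₂) eq)))))))
    where
    remQuot-injective : ∀ {a} b (i j : Fin (a * b)) → remQuot {a} b i ≡ remQuot b j → i ≡ j
    remQuot-injective {a} b i j h =
      trans (sym (Fin.combine-remQuot {a} b i)) (trans (cong (λ (x , y) → combine x y) h) (Fin.combine-remQuot {a} b j))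
    cast-injective : ∀ {a b} (a≡b : a ≡ b) {i j : Fin a} → cast a≡b i ≡ cast a≡b j → i ≡ j
    cast-injective a≡b {i} {j} h = Fin.toℕ-injective
      (trans (sym (Fin.toℕ-cast a≡b i)) (trans (cong toℕ h) (Fin.toℕ-cast a≡b j)))

  -- Two coinciding vertices are either the two ends of one edge, or one of them lies off an edge
  -- ending at the other and is trivially collinear with that edge.
  point-injective : ∀ {u v} → Endpoint u → Endpoint v → P u ≡ P v → u ≡ v
  point-injective {u} {v} (e , u∈e) (f , v∈f) eq = decidable-stable (u Fin.≟ v) λ u≢v → separate u≢v u∈e
    where
    a = proj₁ (edge G e)
    b = proj₂ (edge G e)
    Pv⊝Pv = u⊝u≡𝟎 (P v)
    separate : u ≢ v → u ≡ a ⊎ u ≡ b → ⊥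
    separate u≢v (inj₁ refl) with v Fin.≟ b
    ... | yes refl = edge-nondegenerate G X Y Z generic e refl eq
    ... | no v≢b = endpoint-noncollinear G X Y Z generic e f refl refl v∈f (u≢v ∘ sym) v≢b
      (cong (_⨯ (P b ⊝ P v)) (trans (cong (_⊝ P v) eq) Pv⊝Pv))
    separate u≢v (inj₂ refl) with v Fin.≟ a
    ... | yes refl = edge-nondegenerate G X Y Z generic e refl (sym eq)
    ... | no v≢a = endpoint-noncollinear G X Y Z generic e f refl refl v∈f v≢a (u≢v ∘ sym)
      (⨯≡𝟎-sym (P b ⊝ P v) (P a ⊝ P v) (cong (_⨯ (P a ⊝ P v)) (trans (cong (_⊝ P v) eq) Pv⊝Pv)))

  place-injective : ∀ u v du dv → place u du ≡ place v dv → u ≡ v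
  place-injective u v (yes eu) (yes ev) eq =
    point-injective eu ev (trans (sym (embed-inner u)) (trans (cong embed eq) (embed-inner v)))
  place-injective u v (yes _)  (no _)   eq =
    contradiction (inner-low u) (≤⇒≯ (subst (λ p → M ≤ pz p) (sym eq) (outer-high v)))
  place-injective u v (no _)   (yes _)  eq =
    contradiction (inner-low v) (≤⇒≯ (subst (λ p → M ≤ pz p) eq (outer-high u)))
  place-injective u v (no _)   (no _)   eq = outer-injective u v eq

  onSegment-low : ∀ (a b p : Point m) → pz a < M → pz b < M → OnSegment a b p → pz p < M
  onSegment-low a b p a<M b<M (s , t , 1≤s+t , _ , _ , eq) = *-cancelˡ-< (s + t) (pz p) M (begin-strict
    -- The strict step adds `s + t`, which raises both endpoint heights by one and so turns them
    -- into bounds by `M`.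
    (s + t) * pz p                   ≡⟨ eq ⟩
    s * pz a + t * pz b              <⟨ m<m+n _ 1≤s+t ⟩
    s * pz a + t * pz b + (s + t)    ≡⟨ regroup s t (pz a) (pz b) ⟩
    s * suc (pz a) + t * suc (pz b)  ≤⟨ +-mono-≤ (*-monoʳ-≤ s a<M) (*-monoʳ-≤ t b<M) ⟩
    s * M + t * M                    ≡⟨ *-distribʳ-+ M s t ⟨
    (s + t) * M                      ∎)
    where
    open ≤-Reasoning
    regroup : ∀ s t x y → s * x + t * y + (s + t) ≡ s * (1 + x) + t * (1 + y)
    regroup = solve-∀

  drawing : GridDrawing G m
  drawing = record
    { pos            = position
    ; injective      = λ u v → place-injective u v (endpoint? u) (endpoint? v)
    ; noVertexOnEdge = λ e v v≢a v≢b on → off-edge e v (endpoint? v) v≢a v≢b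
        (subst₂ (λ a b → OnSegment a b (position v)) (source e) (target e) on)
    ; noCrossing     = λ e f e≢f share → edges-noncrossing G X Y Z generic e f e≢f refl refl
        (crossing e f (shareInterior⇒crossing _ _ _ _ (subst₂
          (λ c d → ShareInteriorPoint (inner (src e)) (inner (tgt e)) c d) (source f) (target f)
          (subst₂ (λ a b → ShareInteriorPoint a b (position (src f)) (position (tgt f))) (source e) (target e) share))))
    }
    where
    src tgt : Fin k → Fin n
    src e = proj₁ (edge G e)
    tgt e = proj₂ (edge G e)
    source : ∀ e → position (src e) ≡ inner (src e)
    source e = place-endpoint (e , inj₁ refl) (endpoint? (src e))
    target : ∀ e → position (tgt e) ≡ inner (tgt e)
    target e = place-endpoint (e , inj₂ refl) (endpoint? (tgt e))
    crossing : ∀ e f →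
      Crossing (embed (inner (src e))) (embed (inner (tgt e))) (embed (inner (src f))) (embed (inner (tgt f))) →
      Crossing (P (src e)) (P (tgt e)) (P (src f)) (P (tgt f))
    crossing e f x = subst₂ (λ c d → Crossing (P (src e)) (P (tgt e)) c d)
      (embed-inner (src f)) (embed-inner (tgt f))
      (subst₂ (λ a b → Crossing a b (embed (inner (src f))) (embed (inner (tgt f))))
        (embed-inner (src e)) (embed-inner (tgt e)) x)
    off-edge : ∀ e v d → v ≢ src e → v ≢ tgt e →
      OnSegment (inner (src e)) (inner (tgt e)) (place v d) → ⊥
    off-edge e v (yes (f , v∈f)) v≢a v≢b on = endpoint-noncollinear G X Y Z generic e f refl refl v∈f v≢a v≢b
      (subst (Collinear (P (src e)) (P (tgt e))) (embed-inner v)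
        (subst₂ (λ a b → Collinear a b (embed (inner v))) (embed-inner (src e)) (embed-inner (tgt e))
          (onSegment⇒collinear (inner (src e)) (inner (tgt e)) (inner v) on)))
    off-edge e v (no _) _ _ on = <⇒≱
      (onSegment-low (inner (src e)) (inner (tgt e)) (outer v) (inner-low (src e)) (inner-low (tgt e)) on) (outer-high v)

-- 27 L³ bounds the number of integer vectors of norm at most L, and 24 M³ / 2ʲ the number of
-- solutions in [M]⁴ of a relation of norm about 2ʲ; three coordinates give the cube.
∃drawing : ∀ {n k m} (G : Graph n k) → GridSize (length (quads G)) (27 * 24 ^ 3) n m → GridDrawing G m
∃drawing G size =
  let X , Y , Z , generic = ∃generic (2 ^ r) {{m^n≢0 2 r}} (quads G) (quads-unique G) J 4M²<2ᴶ few
  in drawing {{m^n≢0 2 r}} G X Y Z generic M≤m room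
  where open GridSize size

drawing-exists : ∀ c → 4 * (2 * c + 5) * (27 * 24 ^ 3) < 8 ^ c →
  ∀ (n k : ℕ) (G : Graph n k) → 1 ≤ k →
  ∀ (m : ℕ) → 1 ≤ m → 2 * 8 ^ (2 + c) * (n * k + k * k * ⌈log₂ k ⌉) ≤ m ^ 3 → GridDrawing G m
drawing-exists c K<8ᶜ n k@(suc _) G 1≤k m _ large = ∃drawing G
  (∃gridSize c (27 * 24 ^ 3) K<8ᶜ n k m (length (quads G)) (1≤n (proj₁ (edge G zero))) 1≤k (length-quads G) large)
  where
  1≤n : ∀ {n} → Fin n → 1 ≤ n
  1≤n {suc _} _ = s≤s z≤n

theorem3p1 : Σ ℕ λ C → ∀ (n k : ℕ) (G : Graph n k) → 1 ≤ k →
    ∀ (m : ℕ) → 1 ≤ m → C * (n * k + k * k * ⌈log₂ k ⌉) ≤ m ^ 3 →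
    GridDrawing G m
-- Nine is the least admissible `c`: `4 * 23 * (27 * 24 ^ 3)` is 34338816, below `8 ^ 9`, which is
-- 134217728, while 8 fails.
theorem3p1 = 2 * 8 ^ (2 + 9) , drawing-exists 9 (<ᵇ⇒< _ _ tt)
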